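{- For an integer $m\ge0$ let $\mathbf{S}_m=\{1,\dots,m\}^2$; say two squares $(i,j),(i',j')$ are on a common diagonal if $i-j=i'-j'$ or $i+j=i'+j'$. Let $R_{\mathbf{W}}(m,k)$ (resp. $R_{\mathbf{K}}(m,k)$) be the number of $k$-element subsets of $\{(i,j)\in\mathbf{S}_m:i+j\text{ even}\}$ (resp. $i+j$ odd) with no two distinct elements on a common diagonal, and let $B_{\mathbf{S}}(m,k)$ be the number of $k$-element subsets of $\mathbf{S}_m$ with no two distinct elements on a common diagonal. Let $\pi(m)=1$ if $m$ is odd and $0$ otherwise. For integers $k\ge0$, $0\le d\le 2k$ and $\varepsilon\in\{0,1\}$ define $$c^{\mathbf{W}}_d(k,\varepsilon)=\sum_{i=d}^{2k}\frac{(-1)^{i-d}}{i!}\left[{i\atop d}\right]\sum_{p=\max(0,i-k)}^{k}\sum_{j=p}^{k}\left\{\!\!\left\{ {p+j \atop p}\right\}\!\!\right\}\beta_i(p+j,k-j,-\varepsilon),$$ $$c^{\mathbf{K}}_d(k,\varepsilon)=\sum_{i=d}^{2k}\frac{(-1)^{i-d}}{i!}\left[{i\atop d}\right]\sum_{p=\max(0,i-k)}^{k}\sum_{j=p}^{k}\left\{\!\!\left\{ {p+j \atop p}\right\}\!\!\right\}\beta_i(p+j,k-j,\varepsilon).$$ Then for all integers $m,k\ge0$, $$R_{\mathbf{W}}(m,k)=\sum_{d=0}^{2k}c^{\mathbf{W}}_d(k,\pi(m))\,m^d,\qquad R_{\mathbf{K}}(m,k)=\sum_{d=0}^{2k}c^{\mathbf{K}}_d(k,\pi(m))\,m^d,$$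 and $$B_{\mathbf{S}}(m,k)=\sum_{d=0}^{2k}\left(\sum_{j=0}^{k}\sum_{i=0}^{d}c^{\mathbf{W}}_i(j,\pi(m))\,c^{\mathbf{K}}_{d-i}(k-j,\pi(m))\right)m^d,$$ where $c^{\mathbf{W}}_i(j,\varepsilon)$ and $c^{\mathbf{K}}_i(j,\varepsilon)$ are taken to be $0$ when $i>2j$.
   Context: $\left[{i\atop d}\right]$ denotes the unsigned Stirling number of the first kind. $\left\{\!\!\left\{ {n \atop r}\right\}\!\!\right\}$ denotes the associated Stirling number of the second kind, defined for integers $n,r\ge0$ by $\left\{\!\!\left\{ {n \atop r}\right\}\!\!\right\}=r\left\{\!\!\left\{ {n-1 \atop r}\right\}\!\!\right\}+(n-1)\left\{\!\!\left\{ {n-2 \atop r-1}\right\}\!\!\right\}$ with $\left\{\!\!\left\{ {0 \atop r}\right\}\!\!\right\}=\delta_{r0}$, $\left\{\!\!\left\{ {1 \atop r}\right\}\!\!\right\}=0$, $\left\{\!\!\left\{ {n \atop 0}\right\}\!\!\right\}=\delta_{n0}$ (the number of partitions of an $n$-set into $r$ blocks each of size at least 2). For nonnegative integers $p,q$, an integer $z$ and $0\le i\le p+q$, $$\beta_i(p,q,z)=\frac{1}{2^{2q}}\sum_{b=\max(0,i-p)}^{q}2^b\binom{2q-b}{q}\sum_{a=0}^{b}\binom{p+b-q-z}{a}\binom{q+z}{b-a}\binom{a-q}{p+b-i},$$ where $\binom{y}{n}=y(y-1)\cdots(y-n+1)/n!$ for integer $n\ge0$ and any $y$. -}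

module Defs where

open import Data.Integer.Base as ℤ using (ℤ; +_; _⊖_; -1ℤ; 1ℤ)
import Data.Integer.Properties as ℤ
open import Data.List.Base using (List; []; _∷_; _++_; map; foldr; length; filter; applyUpTo; cartesianProduct)
open import Data.List.Relation.Unary.All using (All; all?)
open import Data.Nat.Base as ℕ using (ℕ; zero; suc; _∸_; _%_; _!)
import Data.Nat.Properties as ℕ
open import Data.Nat.Divisibility using (_∣_; _∣?_)
open import Data.Product.Base using (_×_; _,_)
open import Data.Product.Properties using (≡-dec)
open import Data.Rational.Base using (ℚ; 0ℚ; _/_; _+_; _*_)
open import Data.Sum.Base using (_⊎_)
open import Relation.Binary.PropositionalEquality.Core using (_≡_; _≢_)
open import Relation.Nullary.Decidable using (Dec; ¬?; _⊎-dec_; _→-dec_)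
open import Relation.Nullary.Negation using (¬_)

-- lo, lo + 1, …, hi; empty when hi < lo.
range : ℕ → ℕ → List ℕ
range lo hi = applyUpTo (lo ℕ.+_) (suc hi ∸ lo)

∑ : ℕ → ℕ → (ℕ → ℚ) → ℚ
∑ lo hi f = foldr _+_ 0ℚ (map f (range lo hi))

infix 5 ∑
syntax ∑ lo hi (λ i → e) = ∑[ i from lo to hi ] e

fromℕ : ℕ → ℚ
fromℕ n = + n / 1

Square : Set
Square = ℕ × ℕ

board : ℕ → List Square
board m = cartesianProduct (range 1 m) (range 1 m)

Even : Square → Set
Even (i , j) = 2 ∣ i ℕ.+ j

even? : ∀ s → Dec (Even s)
even? (i , j) = 2 ∣? i ℕ.+ j

whiteBoard : ℕ → List Square
whiteBoard m = filter even? (board m)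

blackBoard : ℕ → List Square
blackBoard m = filter (λ s → ¬? (even? s)) (board m)

-- i ⊖ j is the integer i − j.
CommonDiagonal : Square → Square → Set
CommonDiagonal (i , j) (i′ , j′) = i ⊖ j ≡ i′ ⊖ j′ ⊎ i ℕ.+ j ≡ i′ ℕ.+ j′

commonDiagonal? : ∀ s t → Dec (CommonDiagonal s t)
commonDiagonal? (i , j) (i′ , j′) =
  (i ⊖ j ℤ.≟ i′ ⊖ j′) ⊎-dec (i ℕ.+ j ℕ.≟ i′ ℕ.+ j′)

NonAttacking : List Square → Set
NonAttacking T = All (λ s → All (λ t → s ≢ t → ¬ CommonDiagonal s t) T) T

nonAttacking? : ∀ T → Dec (NonAttacking T)
nonAttacking? T =
  all? (λ s → all? (λ t → ¬? (≡-dec ℕ._≟_ ℕ._≟_ s t) →-dec ¬? (commonDiagonal? s t)) T) T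

-- When xs has no repeated entries (as is the case for the boards above),
-- every k-element subset of xs is listed exactly once, as a sublist of xs.
subsetsOfSize : ∀ {A : Set} → ℕ → List A → List (List A)
subsetsOfSize zero    xs       = [] ∷ []
subsetsOfSize (suc k) []       = []
subsetsOfSize (suc k) (x ∷ xs) = map (x ∷_) (subsetsOfSize k xs) ++ subsetsOfSize (suc k) xs

placements : List Square → ℕ → ℕ
placements xs k = length (filter nonAttacking? (subsetsOfSize k xs))

R-W R-K B-S : ℕ → ℕ → ℕ
R-W m = placements (whiteBoard m)
R-K m = placements (blackBoard m)
B-S m = placements (board m)

π : ℕ → ℕ
π m = m % 2

-- Unsigned: permutations of i points with d cycles.
stirling₁ : ℕ → ℕ → ℕ
stirling₁ zero    zero    = 1
stirling₁ zero    (suc d) = 0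
stirling₁ (suc i) zero    = 0
stirling₁ (suc i) (suc d) = i ℕ.* stirling₁ i (suc d) ℕ.+ stirling₁ i d

-- Partitions of an n-set into r blocks, each of size at least 2.
assocStirling₂ : ℕ → ℕ → ℕ
assocStirling₂ zero          zero    = 1
assocStirling₂ zero          (suc r) = 0
assocStirling₂ (suc zero)    r       = 0
assocStirling₂ (suc (suc n)) zero    = 0
assocStirling₂ (suc (suc n)) (suc r) =
  suc r ℕ.* assocStirling₂ (suc n) (suc r) ℕ.+ suc n ℕ.* assocStirling₂ n r

-- y (y − 1) ⋯ (y − n + 1)
fallingFactorial : ℤ → ℕ → ℤ
fallingFactorial y zero    = 1ℤ
fallingFactorial y (suc n) = fallingFactorial y n ℤ.* (y ℤ.- + n)

binomial : ℤ → ℕ → ℚ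
binomial y n = (fallingFactorial y n / n !) {{ n ℕ.!≢0 }}

-- β i p q z is βᵢ(p, q, z), meant for i ≤ p + q.  The lower limit i ∸ p is
-- max(0, i − p), so i ≤ p + b throughout and p + b ∸ i is not truncated.
β : ℕ → ℕ → ℕ → ℤ → ℚ
β i p q z =
  (1ℤ / 2 ℕ.^ (2 ℕ.* q)) {{ ℕ.m^n≢0 2 (2 ℕ.* q) }} *
  (∑[ b from i ∸ p to q ]
    fromℕ (2 ℕ.^ b) * binomial (+ (2 ℕ.* q) ℤ.- + b) q *
    (∑[ a from 0 to b ]
      binomial (+ p ℤ.+ + b ℤ.- + q ℤ.- z) a *
      binomial (+ q ℤ.+ z) (b ∸ a) *
      binomial (+ a ℤ.- + q) (p ℕ.+ b ∸ i)))

-- The common form of the two coefficient families, with z the last argument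
-- of β.  For d > 2k the outer sum is empty, so the value is 0.
coefficient : ℕ → ℕ → ℤ → ℚ
coefficient d k z =
  ∑[ i from d to 2 ℕ.* k ]
    ((-1ℤ ℤ.^ (i ∸ d)) / i !) {{ i ℕ.!≢0 }} * fromℕ (stirling₁ i d) *
    (∑[ p from i ∸ k to k ] ∑[ j from p to k ]
      fromℕ (assocStirling₂ (p ℕ.+ j) p) * β i (p ℕ.+ j) (k ∸ j) z)

c-W c-K : ℕ → ℕ → ℕ → ℚ
c-W d k ε = coefficient d k (ℤ.- + ε)
c-K d k ε = coefficient d k (+ ε)

{-# OPTIONS --safe #-}
module Submission where

-- Rotating the board by 45° turns bishops of one colour into rooks.  The diagonals i − j = c,
-- sorted by length, form a Ferrers board: the staircase 0, 1, …, m − 1 with one extra cell in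
-- y of its rows, where y = ⌈m/2⌉ for white and ⌊m/2⌋ for black.  A placement of k rooks on the
-- shorter rows attacks exactly k cells of the next one, and the resulting recurrence is solved by
--   ∑ⱼ C(y, k − j) S(m − k + j, m − k),
-- with S(n, n − j) = ∑ₚ {{p + j, p}} C(n, p + j) a Stirling number of the second kind.
--
-- On the other side, the signed Stirling numbers of the first kind turn ∑_d c_d m^d into a sum
-- over i of C(m, i) βᵢ.  Vandermonde's and Riordan's identities, together with
--   ∑_b 2^b C(2q − b, q) C(2y − 2q + b, b) = 4^q C(y, q),
-- evaluate ∑ᵢ C(m, i) βᵢ(p, q, z) to C(m − q, p) C((m − z)/2, q), which gives the same sum.

open import Defs

-- Upper arguments of the binomials go negative: a - q does so inside β, and m - q does so in the
-- final evaluation once k exceeds m. Hence `C`, `E` and `F` are defined for all integers, and their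
-- identities come from recurrences instead of counting. The white diagonals have lengths m, m - 2,
-- m - 2, m - 4, m - 4, ..., that is (m - 1) + 1, m - 2, (m - 3) + 1, m - 4, ...; the black ones
-- have lengths m - 1, m - 1, m - 3, m - 3, ..., that is m - 1, (m - 2) + 1, m - 3, (m - 4) + 1,
-- .... So the colours differ only in which rows carry an extra cell, and the rook count depends on
-- the number y of these rows alone. This number reaches β through m - z = 2y: z = -π(m) gives ⌈m/2⌉
-- and z = π(m) gives ⌊m/2⌋. The two sides meet term by term under q = k - j: C(y, q) appears in the
-- rook count and in the evaluation of β, where the factor 4^q is cancelled by the denominator
-- 2^(2q).

module IntegerIdentities where
  open import Data.Integer.Base using (ℤ; +_; -[1+_]; _+_; _*_; _-_; -_; _^_; 0ℤ; 1ℤ; -1ℤ)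
  open import Data.Integer.Properties
  open import Data.Integer.Tactic.RingSolver using (solve-∀)
  open import Data.Nat.Base as ℕ using (ℕ; zero; suc; _∸_; _!)
  import Data.Nat.Properties as ℕ
  open import Data.Product.Base using (_,_)
  open import Data.Sum.Base using (inj₁; inj₂)
  open import Function.Base using (_∘_)
  open import Relation.Binary.PropositionalEquality
  open ≡-Reasoning

  -- Finite sums and convolutions of integer sequences.

  +-congˡ : ∀ a {b c} → b ≡ c → a + b ≡ a + c
  +-congˡ a refl = refl

  +-congʳ : ∀ c {a b} → a ≡ b → a + c ≡ b + c
  +-congʳ c refl = refl

  *-congˡ : ∀ a {b c} → b ≡ c → a * b ≡ a * c
  *-congˡ a refl = refl

  *-congʳ : ∀ c {a b} → a ≡ b → a * c ≡ b * c
  *-congʳ c refl = refl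

  sumTo : ℕ → (ℕ → ℤ) → ℤ
  sumTo zero    f = f 0
  sumTo (suc n) f = sumTo n f + f (suc n)

  sumTo-cong≤ : ∀ n {f g} → (∀ i → i ℕ.≤ n → f i ≡ g i) → sumTo n f ≡ sumTo n g
  sumTo-cong≤ zero    f≗g = f≗g 0 ℕ.z≤n
  sumTo-cong≤ (suc n) f≗g =
    cong₂ _+_ (sumTo-cong≤ n λ i i≤n → f≗g i (ℕ.m≤n⇒m≤1+n i≤n)) (f≗g (suc n) ℕ.≤-refl)

  sumTo-cong : ∀ n {f g} → (∀ i → f i ≡ g i) → sumTo n f ≡ sumTo n g
  sumTo-cong n f≗g = sumTo-cong≤ n λ i _ → f≗g i

  sumTo-+ : ∀ n f g → sumTo n (λ i → f i + g i) ≡ sumTo n f + sumTo n g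
  sumTo-+ zero    f g = refl
  sumTo-+ (suc n) f g = begin
    sumTo n (λ i → f i + g i) + (f (suc n) + g (suc n))   ≡⟨ +-congʳ (f (suc n) + g (suc n)) (sumTo-+ n f g) ⟩
    sumTo n f + sumTo n g + (f (suc n) + g (suc n))       ≡⟨ medial (sumTo n f) (sumTo n g) (f (suc n)) (g (suc n)) ⟩
    sumTo n f + f (suc n) + (sumTo n g + g (suc n))       ∎
    where
    medial : ∀ a b c d → a + b + (c + d) ≡ a + c + (b + d)
    medial = solve-∀

  sumTo-*ˡ : ∀ n c f → sumTo n (λ i → c * f i) ≡ c * sumTo n f
  sumTo-*ˡ zero    c f = refl
  sumTo-*ˡ (suc n) c f =
    trans (+-congʳ (c * f (suc n)) (sumTo-*ˡ n c f)) (sym (*-distribˡ-+ c (sumTo n f) (f (suc n))))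

  sumTo-head : ∀ n f → sumTo (suc n) f ≡ f 0 + sumTo n (f ∘ suc)
  sumTo-head zero    f = refl
  sumTo-head (suc n) f = trans (+-congʳ (f (suc (suc n))) (sumTo-head n f)) (+-assoc (f 0) (sumTo n (f ∘ suc)) (f (suc (suc n))))

  sumTo-zero : ∀ n {f} → (∀ i → i ℕ.≤ n → f i ≡ 0ℤ) → sumTo n f ≡ 0ℤ
  sumTo-zero n f≗0 = trans (sumTo-cong≤ n f≗0) (const-zero n)
    where
    const-zero : ∀ n → sumTo n (λ _ → 0ℤ) ≡ 0ℤ
    const-zero zero    = refl
    const-zero (suc n) = trans (+-identityʳ _) (const-zero n)

  sumTo-swap : ∀ n m (F : ℕ → ℕ → ℤ) →
               sumTo n (λ i → sumTo m (F i)) ≡ sumTo m (λ j → sumTo n (λ i → F i j))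
  sumTo-swap zero    m F = refl
  sumTo-swap (suc n) m F =
    trans (+-congʳ (sumTo m (F (suc n))) (sumTo-swap n m F)) (sym (sumTo-+ m (λ j → sumTo n (λ i → F i j)) (F (suc n))))

  sumTo-truncate : ∀ m n {f} → (∀ i → n ℕ.< i → f i ≡ 0ℤ) → sumTo (m ℕ.+ n) f ≡ sumTo n f
  sumTo-truncate zero    n f≗0 = refl
  sumTo-truncate (suc m) n {f} f≗0 = begin
    sumTo (m ℕ.+ n) f + f (suc (m ℕ.+ n))   ≡⟨ +-congˡ (sumTo (m ℕ.+ n) f) (f≗0 _ (ℕ.s≤s (ℕ.m≤n+m n m))) ⟩
    sumTo (m ℕ.+ n) f + 0ℤ                  ≡⟨ +-identityʳ _ ⟩
    sumTo (m ℕ.+ n) f                       ≡⟨ sumTo-truncate m n f≗0 ⟩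
    sumTo n f                               ∎

  infixl 7 _⋆_
  _⋆_ : (ℕ → ℤ) → (ℕ → ℤ) → ℕ → ℤ
  (f ⋆ g) n = sumTo n λ i → f i * g (n ∸ i)

  -- In generating functions the hypotheses say f = f′ + c t h; multiply by g. With c = 1 this
  -- carries Pascal's rule and the deletion recurrence of `N` through a product, with c = 2 the
  -- recurrence of `P`.
  ⋆-stepˡ : ∀ c f f′ h g → f 0 ≡ f′ 0 → (∀ n → f (suc n) ≡ f′ (suc n) + c * h n) →
            ∀ n → (f ⋆ g) (suc n) ≡ (f′ ⋆ g) (suc n) + c * (h ⋆ g) n
  ⋆-stepˡ c f f′ h g f₀ f₊ n = begin
    (f ⋆ g) (suc n)
      ≡⟨ sumTo-head n _ ⟩
    f 0 * g (suc n) + sumTo n (λ i → f (suc i) * g (n ∸ i))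
      ≡⟨ cong₂ _+_ (*-congʳ (g (suc n)) f₀) (sumTo-cong n λ i →
           trans (*-congʳ (g (n ∸ i)) (f₊ i)) (expand (f′ (suc i)) c (h i) (g (n ∸ i)))) ⟩
    f′ 0 * g (suc n) + sumTo n (λ i → f′ (suc i) * g (n ∸ i) + c * (h i * g (n ∸ i)))
      ≡⟨ +-congˡ (f′ 0 * g (suc n)) (trans (sumTo-+ n tail _)
           (+-congˡ (sumTo n tail) (sumTo-*ˡ n c λ i → h i * g (n ∸ i)))) ⟩
    f′ 0 * g (suc n) + (sumTo n tail + c * (h ⋆ g) n)
      ≡⟨ +-assoc (f′ 0 * g (suc n)) (sumTo n tail) (c * (h ⋆ g) n) ⟨
    f′ 0 * g (suc n) + sumTo n tail + c * (h ⋆ g) n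
      ≡⟨ +-congʳ (c * (h ⋆ g) n) (sumTo-head n (λ i → f′ i * g (suc n ∸ i))) ⟨
    (f′ ⋆ g) (suc n) + c * (h ⋆ g) n ∎
    where
    tail : ℕ → ℤ
    tail i = f′ (suc i) * g (n ∸ i)
    expand : ∀ a c b d → (a + c * b) * d ≡ a * d + c * (b * d)
    expand = solve-∀

  -- The hypotheses say (1 - t) g = g′; multiply by f.
  ⋆-stepʳ : ∀ f g g′ → g 0 ≡ g′ 0 → (∀ n → g (suc n) ≡ g′ (suc n) + g n) →
            ∀ n → (f ⋆ g) (suc n) ≡ (f ⋆ g′) (suc n) + (f ⋆ g) n
  ⋆-stepʳ f g g′ g₀ g₊ n = begin
    sumTo n (λ i → f i * g (suc n ∸ i)) + f (suc n) * g (n ∸ n)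
      ≡⟨ cong₂ _+_ (sumTo-cong≤ n step) (*-congˡ (f (suc n)) last) ⟩
    sumTo n (λ i → init i + f i * g (n ∸ i)) + f (suc n) * g′ (n ∸ n)
      ≡⟨ +-congʳ (f (suc n) * g′ (n ∸ n)) (sumTo-+ n init _) ⟩
    sumTo n init + (f ⋆ g) n + f (suc n) * g′ (n ∸ n)
      ≡⟨ rotate (sumTo n init) ((f ⋆ g) n) (f (suc n) * g′ (n ∸ n)) ⟩
    (f ⋆ g′) (suc n) + (f ⋆ g) n ∎
    where
    init : ℕ → ℤ
    init i = f i * g′ (suc n ∸ i)
    rotate : ∀ a b c → a + b + c ≡ a + c + b
    rotate = solve-∀
    last : g (n ∸ n) ≡ g′ (n ∸ n)
    last rewrite ℕ.n∸n≡0 n = g₀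
    step : ∀ i → i ℕ.≤ n → f i * g (suc n ∸ i) ≡ f i * g′ (suc n ∸ i) + f i * g (n ∸ i)
    step i i≤n rewrite ℕ.+-∸-assoc 1 i≤n =
      trans (*-congˡ (f i) (g₊ (n ∸ i))) (*-distribˡ-+ (f i) (g′ (suc (n ∸ i))) (g (n ∸ i)))

  δ : ℕ → ℤ
  δ zero    = 1ℤ
  δ (suc n) = 0ℤ

  ⋆-identityˡ : ∀ g n → (δ ⋆ g) n ≡ g n
  ⋆-identityˡ g zero    = *-identityˡ (g 0)
  ⋆-identityˡ g (suc n) = begin
    (δ ⋆ g) (suc n)                                     ≡⟨ sumTo-head n _ ⟩
    1ℤ * g (suc n) + sumTo n (λ i → 0ℤ * g (n ∸ i))     ≡⟨ cong₂ _+_ (*-identityˡ (g (suc n))) (sumTo-zero n λ i _ → *-zeroˡ (g (n ∸ i))) ⟩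
    g (suc n) + 0ℤ                                      ≡⟨ +-identityʳ _ ⟩
    g (suc n)                                           ∎

  -- Multiplication of the generating function by t^j.
  shift : ℕ → (ℕ → ℤ) → ℕ → ℤ
  shift zero    f n       = f n
  shift (suc j) f zero    = 0ℤ
  shift (suc j) f (suc n) = shift j f n

  ⋆-shift : ∀ j f g n → (shift j f ⋆ g) (j ℕ.+ n) ≡ (f ⋆ g) n
  ⋆-shift zero    f g n = refl
  ⋆-shift (suc j) f g n = begin
    (shift (suc j) f ⋆ g) (suc (j ℕ.+ n))          ≡⟨ sumTo-head (j ℕ.+ n) _ ⟩
    0ℤ * g (suc (j ℕ.+ n)) + (shift j f ⋆ g) (j ℕ.+ n)  ≡⟨ +-congʳ ((shift j f ⋆ g) (j ℕ.+ n)) (*-zeroˡ (g (suc (j ℕ.+ n)))) ⟩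
    0ℤ + (shift j f ⋆ g) (j ℕ.+ n)                 ≡⟨ +-identityˡ _ ⟩
    (shift j f ⋆ g) (j ℕ.+ n)                      ≡⟨ ⋆-shift j f g n ⟩
    (f ⋆ g) n                                      ∎

  -- Binomial coefficients with integer upper argument.

  -- Pascal's rule extended to negative upper arguments.
  C : ℤ → ℕ → ℤ
  C y             zero    = 1ℤ
  C (+ zero)      (suc n) = 0ℤ
  C (+ suc m)     (suc n) = C (+ m) (suc n) + C (+ m) n
  C -[1+ zero ]   (suc n) = - C -[1+ zero ] n
  C -[1+ suc m ]  (suc n) = C -[1+ m ] (suc n) - C -[1+ suc m ] n

  pascal : ∀ y n → C (1ℤ + y) (suc n) ≡ C y (suc n) + C y n
  pascal (+ m) n = refl
  pascal -[1+ zero ] n = sym (+-inverseˡ (C -[1+ zero ] n))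
  pascal -[1+ suc m ] n = cancel (C -[1+ m ] (suc n)) (C -[1+ suc m ] n)
    where
    cancel : ∀ a b → a ≡ a - b + b
    cancel = solve-∀

  -- The weight c n is 1 for binomial coefficients and n + 1 for falling factorials.
  Pascal : (ℕ → ℤ) → (ℤ → ℕ → ℤ) → Set
  Pascal c f = ∀ y n → f (1ℤ + y) (suc n) ≡ f y (suc n) + c n * f y n

  -- The recurrence gives row 1 + y from row y and, with column 0 known, also row y from row 1 + y
  -- by induction on n. From row 0 it therefore reaches every integer y.
  pascal-unique : ∀ c f g → Pascal c f → Pascal c g →
                  (∀ y → f y 0 ≡ g y 0) → (∀ n → f 0ℤ n ≡ g 0ℤ n) → ∀ y n → f y n ≡ g y n
  pascal-unique c f g pf pg col row = agree
    where
    backward : ∀ y → (∀ n → f (1ℤ + y) n ≡ g (1ℤ + y) n) → ∀ n → f y n ≡ g y n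
    backward y eq zero    = col y
    backward y eq (suc n) = begin
      f y (suc n)                            ≡⟨ move (pf y n) ⟩
      f (1ℤ + y) (suc n) - c n * f y n       ≡⟨ cong₂ (λ a b → a - c n * b) (eq (suc n)) (backward y eq n) ⟩
      g (1ℤ + y) (suc n) - c n * g y n       ≡⟨ move (pg y n) ⟨
      g y (suc n)                            ∎
      where
      move′ : ∀ a b → b ≡ b + a - a
      move′ = solve-∀
      move : ∀ {a b d} → d ≡ b + a → b ≡ d - a
      move {a} {b} refl = move′ a b
    forward : ∀ y → (∀ n → f y n ≡ g y n) → ∀ n → f (1ℤ + y) n ≡ g (1ℤ + y) n
    forward y eq zero    = col (1ℤ + y)
    forward y eq (suc n) = begin
      f (1ℤ + y) (suc n)            ≡⟨ pf y n ⟩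
      f y (suc n) + c n * f y n     ≡⟨ cong₂ (λ a b → a + c n * b) (eq (suc n)) (eq n) ⟩
      g y (suc n) + c n * g y n     ≡⟨ pg y n ⟨
      g (1ℤ + y) (suc n)            ∎
    agree : ∀ y n → f y n ≡ g y n
    agree (+ zero)       = row
    agree (+ suc m)      = forward (+ m) (agree (+ m))
    agree -[1+ zero ]    = backward -[1+ zero ] row
    agree -[1+ suc m ]   = backward -[1+ suc m ] (agree -[1+ m ])

  C-Pascal : Pascal (λ _ → 1ℤ) C
  C-Pascal y n = trans (pascal y n) (+-congˡ (C y (suc n)) (sym (*-identityˡ (C y n))))

  C-0 : ∀ n → C 0ℤ n ≡ δ n
  C-0 zero    = refl
  C-0 (suc n) = refl

  -- For fixed y both sides obey Pascal's rule in x, so comparing them at x = 0 suffices, where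
  -- `C 0ℤ` is the unit of convolution.
  vandermonde : ∀ x y n → (C x ⋆ C y) n ≡ C (x + y) n
  vandermonde x y n = pascal-unique (λ _ → 1ℤ) (λ x → C x ⋆ C y) (λ x → C (x + y))
    (λ x → ⋆-stepˡ 1ℤ (C (1ℤ + x)) (C x) (C x) (C y) refl (C-Pascal x))
    (λ x n → trans (cong (λ t → C t (suc n)) (+-assoc 1ℤ x y)) (C-Pascal (x + y) n))
    (λ x → refl)
    (λ n → trans (sumTo-cong n λ i → cong (_* C y (n ∸ i)) (C-0 i))
             (trans (⋆-identityˡ (C y) n) (cong (λ t → C t n) (sym (+-identityˡ y)))))
    x n

  ff-step : ∀ y n → fallingFactorial (1ℤ + y) (suc n) ≡ (1ℤ + y) * fallingFactorial y n
  ff-step y zero    = base y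
    where
    base : ∀ y → 1ℤ * (1ℤ + y - 0ℤ) ≡ (1ℤ + y) * 1ℤ
    base = solve-∀
  ff-step y (suc n) = trans (cong (_* (1ℤ + y - (1ℤ + + n))) (ff-step y n))
                            (rearrange y (fallingFactorial y n) (+ n))
    where
    rearrange : ∀ y f n → (1ℤ + y) * f * (1ℤ + y - (1ℤ + n)) ≡ (1ℤ + y) * (f * (y - n))
    rearrange = solve-∀

  ff-Pascal : Pascal (λ n → + suc n) fallingFactorial
  ff-Pascal y n = trans (ff-step y n) (rearrange y (fallingFactorial y n) (+ n))
    where
    rearrange : ∀ y f n → (1ℤ + y) * f ≡ f * (y - n) + (1ℤ + n) * f
    rearrange = solve-∀

  -- The factor n! turns the weight 1 of `C-Pascal` into n + 1, the weight of `ff-Pascal`. So the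
  -- binomials of the theorem are integers, and below factorials are cancelled where one would
  -- otherwise divide.
  ff≡!*C : ∀ y n → fallingFactorial y n ≡ + (n !) * C y n
  ff≡!*C = pascal-unique (λ n → + suc n) fallingFactorial (λ y n → + (n !) * C y n)
    ff-Pascal step (λ y → refl) row
    where
    rearrange : ∀ s f a b → s * f * (a + b) ≡ s * f * a + s * (f * b)
    rearrange = solve-∀
    step : Pascal (λ n → + suc n) (λ y n → + (n !) * C y n)
    step y n = begin
      + (suc n !) * C (1ℤ + y) (suc n)                          ≡⟨ cong₂ _*_ (pos-* (suc n) (n !)) (pascal y n) ⟩
      + suc n * + (n !) * (C y (suc n) + C y n)                 ≡⟨ rearrange (+ suc n) (+ (n !)) (C y (suc n)) (C y n) ⟩
      + suc n * + (n !) * C y (suc n) + + suc n * (+ (n !) * C y n)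
        ≡⟨ cong (λ t → t * C y (suc n) + + suc n * (+ (n !) * C y n)) (pos-* (suc n) (n !)) ⟨
      + (suc n !) * C y (suc n) + + suc n * (+ (n !) * C y n)   ∎
    row : ∀ n → fallingFactorial 0ℤ n ≡ + (n !) * C 0ℤ n
    row zero          = refl
    row (suc zero)    = refl
    row (suc (suc n)) = begin
      fallingFactorial 0ℤ (suc n) * (0ℤ - + suc n)   ≡⟨ cong (_* (0ℤ - + suc n)) (trans (row (suc n)) (*-zeroʳ (+ (suc n !)))) ⟩
      0ℤ * (0ℤ - + suc n)                            ≡⟨⟩
      0ℤ                                             ≡⟨ *-zeroʳ (+ (suc (suc n) !)) ⟨
      + (suc (suc n) !) * 0ℤ                         ∎

  +!-cancelˡ : ∀ n {a b} → + (n !) * a ≡ + (n !) * b → a ≡ b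
  +!-cancelˡ n {a} {b} = *-cancelˡ-≡ (+ (n !)) a b {{n ℕ.!≢0}}

  absorption : ∀ y n → + suc n * C y (suc n) ≡ (y - + n) * C y n
  absorption y n = +!-cancelˡ n (begin
    + (n !) * (+ suc n * C y (suc n))   ≡⟨ rearrange (+ (n !)) (+ suc n) _ ⟩
    + suc n * + (n !) * C y (suc n)     ≡⟨ cong (_* C y (suc n)) (pos-* (suc n) (n !)) ⟨
    + (suc n !) * C y (suc n)           ≡⟨ ff≡!*C y (suc n) ⟨
    fallingFactorial y n * (y - + n)    ≡⟨ cong (_* (y - + n)) (ff≡!*C y n) ⟩
    + (n !) * C y n * (y - + n)         ≡⟨ rearrange′ (+ (n !)) (C y n) _ ⟩
    + (n !) * ((y - + n) * C y n)       ∎)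
    where
    rearrange : ∀ a b c → a * (b * c) ≡ b * a * c
    rearrange = solve-∀
    rearrange′ : ∀ a b c → a * b * c ≡ a * (c * b)
    rearrange′ = solve-∀

  C-vanish : ∀ {m n} → m ℕ.< n → C (+ m) n ≡ 0ℤ
  C-vanish {zero}  {suc n} _           = refl
  C-vanish {suc m} {suc n} (ℕ.s≤s m<n) = cong₂ _+_ (C-vanish (ℕ.m<n⇒m<1+n m<n)) (C-vanish m<n)

  C-diagonal : ∀ n → C (+ n) n ≡ 1ℤ
  C-diagonal zero    = refl
  C-diagonal (suc n) = cong₂ _+_ (C-vanish (ℕ.n<1+n n)) (C-diagonal n)

  ff-+ : ∀ y j l → fallingFactorial y (j ℕ.+ l) ≡ fallingFactorial y j * fallingFactorial (y - + j) l
  ff-+ y j zero rewrite ℕ.+-identityʳ j = sym (*-identityʳ _)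
  ff-+ y j (suc l) rewrite ℕ.+-suc j l | ff-+ y j l =
    rearrange (fallingFactorial y j) (fallingFactorial (y - + j) l) y (+ j) (+ l)
    where
    rearrange : ∀ a b y j l → a * b * (y - (j + l)) ≡ a * (b * (y - j - l))
    rearrange = solve-∀

  !*C-+ : ∀ y j l → + ((j ℕ.+ l) !) * C y (j ℕ.+ l) ≡ + (j !) * C y j * (+ (l !) * C (y - + j) l)
  !*C-+ y j l = begin
    + ((j ℕ.+ l) !) * C y (j ℕ.+ l)                       ≡⟨ ff≡!*C y (j ℕ.+ l) ⟨
    fallingFactorial y (j ℕ.+ l)                          ≡⟨ ff-+ y j l ⟩
    fallingFactorial y j * fallingFactorial (y - + j) l   ≡⟨ cong₂ _*_ (ff≡!*C y j) (ff≡!*C (y - + j) l) ⟩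
    + (j !) * C y j * (+ (l !) * C (y - + j) l)           ∎

  a+b-a≡b : ∀ a b → a + b - a ≡ b
  a+b-a≡b = solve-∀

  !*!*C : ∀ j l → + (j !) * (+ (l !) * C (+ (j ℕ.+ l)) j) ≡ + ((j ℕ.+ l) !)
  !*!*C j l = sym (begin
    + ((j ℕ.+ l) !)                                       ≡⟨ *-identityʳ _ ⟨
    + ((j ℕ.+ l) !) * 1ℤ                                  ≡⟨ cong (+ ((j ℕ.+ l) !) *_) (C-diagonal (j ℕ.+ l)) ⟨
    + ((j ℕ.+ l) !) * C (+ (j ℕ.+ l)) (j ℕ.+ l)           ≡⟨ !*C-+ (+ (j ℕ.+ l)) j l ⟩
    + (j !) * c * (+ (l !) * C (+ j + + l - + j) l)       
      ≡⟨ cong (λ t → + (j !) * c * (+ (l !) * t)) (trans (cong (λ t → C t l) (a+b-a≡b (+ j) (+ l))) (C-diagonal l)) ⟩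
    + (j !) * c * (+ (l !) * 1ℤ)                          ≡⟨ rearrange (+ (j !)) c (+ (l !)) ⟩
    + (j !) * (+ (l !) * c)                               ∎)
    where
    c = C (+ (j ℕ.+ l)) j
    rearrange : ∀ a b c → a * b * (c * 1ℤ) ≡ a * (c * b)
    rearrange = solve-∀

  -- Multiplied by j! l!, both sides become the falling factorial of y of length j + l, on the right
  -- split after j factors. This is valid for negative y too.
  trinomial-revision : ∀ y j l → C y (j ℕ.+ l) * C (+ (j ℕ.+ l)) j ≡ C y j * C (y - + j) l
  trinomial-revision y j l = +!-cancelˡ j (+!-cancelˡ l (begin
    + (l !) * (+ (j !) * (C y (j ℕ.+ l) * C (+ (j ℕ.+ l)) j))   ≡⟨ rearrange (+ (l !)) (+ (j !)) (C y (j ℕ.+ l)) _ ⟩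
    + (j !) * (+ (l !) * C (+ (j ℕ.+ l)) j) * C y (j ℕ.+ l)     ≡⟨ cong (_* C y (j ℕ.+ l)) (!*!*C j l) ⟩
    + ((j ℕ.+ l) !) * C y (j ℕ.+ l)                             ≡⟨ !*C-+ y j l ⟩
    + (j !) * C y j * (+ (l !) * C (y - + j) l)                 ≡⟨ rearrange′ (+ (j !)) (C y j) (+ (l !)) _ ⟩
    + (l !) * (+ (j !) * (C y j * C (y - + j) l))               ∎))
    where
    rearrange : ∀ a b c d → a * (b * (c * d)) ≡ b * (a * d) * c
    rearrange = solve-∀
    rearrange′ : ∀ a b c d → a * b * (c * d) ≡ c * (a * (b * d))
    rearrange′ = solve-∀

  C-symmetric : ∀ j l → C (+ (j ℕ.+ l)) j ≡ C (+ (j ℕ.+ l)) l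
  C-symmetric j l = +!-cancelˡ j (+!-cancelˡ l (begin
    + (l !) * (+ (j !) * C (+ (j ℕ.+ l)) j)   ≡⟨ rearrange (+ (l !)) (+ (j !)) _ ⟩
    + (j !) * (+ (l !) * C (+ (j ℕ.+ l)) j)   ≡⟨ !*!*C j l ⟩
    + ((j ℕ.+ l) !)                           ≡⟨ cong (λ t → + (t !)) (ℕ.+-comm j l) ⟩
    + ((l ℕ.+ j) !)                           ≡⟨ !*!*C l j ⟨
    + (l !) * (+ (j !) * C (+ (l ℕ.+ j)) l)   ≡⟨ cong (λ t → + (l !) * (+ (j !) * C (+ t) l)) (ℕ.+-comm l j) ⟩
    + (l !) * (+ (j !) * C (+ (j ℕ.+ l)) l)   ∎))
    where
    rearrange : ∀ a b c → a * (b * c) ≡ b * (a * c)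
    rearrange = solve-∀

  -- Trinomial revision moves C(u, j) out of C(u, a) C(a, j) and leaves an ordinary Vandermonde sum
  -- starting at a = j; the terms with a < j vanish. This is the inner sum of Riordan's identity.
  weighted-vandermonde : ∀ u v j l →
    sumTo (j ℕ.+ l) (λ a → C u a * C (+ a) j * C v (j ℕ.+ l ∸ a)) ≡ C u j * C (u - + j + v) l
  weighted-vandermonde u v j l = begin
    sumTo (j ℕ.+ l) (λ a → C u a * C (+ a) j * C v (j ℕ.+ l ∸ a))
      ≡⟨ sumTo-cong (j ℕ.+ l) (λ a → trans (cong (_* C v (j ℕ.+ l ∸ a)) (revise a)) (*-assoc (C u j) _ _)) ⟩
    sumTo (j ℕ.+ l) (λ a → C u j * (shift j (C (u - + j)) a * C v (j ℕ.+ l ∸ a)))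
      ≡⟨ sumTo-*ˡ (j ℕ.+ l) (C u j) _ ⟩
    C u j * (shift j (C (u - + j)) ⋆ C v) (j ℕ.+ l)
      ≡⟨ cong (C u j *_) (trans (⋆-shift j (C (u - + j)) (C v) l) (vandermonde (u - + j) v l)) ⟩
    C u j * C (u - + j + v) l ∎
    where
    shift-< : ∀ {a j} f → a ℕ.< j → shift j f a ≡ 0ℤ
    shift-< {zero}  f (ℕ.s≤s _)   = refl
    shift-< {suc a} f (ℕ.s≤s a<j) = shift-< f a<j
    shift-+ : ∀ j f l → shift j f (j ℕ.+ l) ≡ f l
    shift-+ zero    f l = refl
    shift-+ (suc j) f l = shift-+ j f l
    revise : ∀ a → C u a * C (+ a) j ≡ C u j * shift j (C (u - + j)) a
    revise a with ℕ.<-≤-connex a j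
    ... | inj₁ a<j = trans (trans (cong (C u a *_) (C-vanish a<j)) (*-zeroʳ (C u a)))
                           (sym (trans (cong (C u j *_) (shift-< (C (u - + j)) a<j)) (*-zeroʳ (C u j))))
    ... | inj₂ j≤a with k , refl ← ℕ.m≤n⇒∃[o]m+o≡n j≤a =
      trans (trinomial-revision u j k) (cong (C u j *_) (sym (shift-+ j _ k)))

  -- Equation (5.28) of Concrete Mathematics.
  riordan : ∀ r s M n →
    sumTo n (λ a → C (+ M - r + s) a * C (+ n + r - s) (n ∸ a) * C (r + + a) (M ℕ.+ n)) ≡ C r M * C s n
  riordan r s M n = begin
    sumTo n (λ a → C u a * C v (n ∸ a) * C (r + + a) (M ℕ.+ n))
      -- Expanding C(r + a, M + n) by Vandermonde leaves, for each j, a weighted Vandermonde sum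
      -- over a; the j above n contribute nothing because a ≤ n < j.
      ≡⟨ sumTo-cong n (λ a → trans (cong (C u a * C v (n ∸ a) *_)
           (trans (cong (λ t → C t (M ℕ.+ n)) (+-comm r (+ a))) (sym (vandermonde (+ a) r (M ℕ.+ n)))))
           (sym (sumTo-*ˡ (M ℕ.+ n) (C u a * C v (n ∸ a)) _))) ⟩
    sumTo n (λ a → sumTo (M ℕ.+ n) λ j → C u a * C v (n ∸ a) * (C (+ a) j * C r (M ℕ.+ n ∸ j)))
      ≡⟨ sumTo-swap n (M ℕ.+ n) _ ⟩
    sumTo (M ℕ.+ n) (λ j → sumTo n λ a → C u a * C v (n ∸ a) * (C (+ a) j * C r (M ℕ.+ n ∸ j)))
      ≡⟨ sumTo-truncate M n (λ j n<j → sumTo-zero n λ a a≤n →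
           trans (cong (λ t → C u a * C v (n ∸ a) * (t * C r (M ℕ.+ n ∸ j))) (C-vanish (ℕ.≤-<-trans a≤n n<j)))
                 (zero-term (C u a * C v (n ∸ a)) (C r (M ℕ.+ n ∸ j)))) ⟩
    sumTo n (λ j → sumTo n λ a → C u a * C v (n ∸ a) * (C (+ a) j * C r (M ℕ.+ n ∸ j)))
      ≡⟨ sumTo-cong≤ n (λ j j≤n → inner j j≤n) ⟩
    sumTo n (λ j → C r M * (C u j * C (r - + M) (n ∸ j)))
      ≡⟨ sumTo-*ˡ n (C r M) _ ⟩
    C r M * (C u ⋆ C (r - + M)) n
      ≡⟨ cong (C r M *_) (trans (vandermonde u (r - + M) n) (cong (λ t → C t n) (collapse (+ M) r s))) ⟩
    C r M * C s n ∎
    where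
    u = + M - r + s
    v = + n + r - s
    zero-term : ∀ a b → a * (0ℤ * b) ≡ 0ℤ
    zero-term = solve-∀
    collapse : ∀ M r s → M - r + s + (r - M) ≡ s
    collapse = solve-∀
    rearrange : ∀ a b c d → a * b * (c * d) ≡ d * (a * c * b)
    rearrange = solve-∀
    top : ∀ M r s j l → M - r + s - j + (j + l + r - s) ≡ M + l
    top = solve-∀
    reassociate : ∀ a b c d → a * b ≡ c * d → ∀ e → a * (e * b) ≡ c * (e * d)
    reassociate a b c d eq e = trans (out a b e) (trans (cong (e *_) eq) (sym (out c d e)))
      where
      out : ∀ a b e → a * (e * b) ≡ e * (a * b)
      out = solve-∀
    inner : ∀ j → j ℕ.≤ n → sumTo n (λ a → C u a * C v (n ∸ a) * (C (+ a) j * C r (M ℕ.+ n ∸ j)))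
                           ≡ C r M * (C u j * C (r - + M) (n ∸ j))
    inner j j≤n with l , refl ← ℕ.m≤n⇒∃[o]m+o≡n j≤n = begin
      sumTo (j ℕ.+ l) (λ a → C u a * C v (j ℕ.+ l ∸ a) * (C (+ a) j * C r (M ℕ.+ (j ℕ.+ l) ∸ j)))
        ≡⟨ sumTo-cong (j ℕ.+ l) (λ a → rearrange (C u a) _ (C (+ a) j) _) ⟩
      sumTo (j ℕ.+ l) (λ a → C r (M ℕ.+ (j ℕ.+ l) ∸ j) * (C u a * C (+ a) j * C v (j ℕ.+ l ∸ a)))
        ≡⟨ sumTo-*ˡ (j ℕ.+ l) (C r (M ℕ.+ (j ℕ.+ l) ∸ j)) _ ⟩
      C r (M ℕ.+ (j ℕ.+ l) ∸ j) * sumTo (j ℕ.+ l) (λ a → C u a * C (+ a) j * C v (j ℕ.+ l ∸ a))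
        ≡⟨ cong₂ _*_ (cong (C r) (trans (ℕ.+-∸-assoc M (ℕ.m≤m+n j l)) (cong (M ℕ.+_) (ℕ.m+n∸m≡n j l))))
                     (weighted-vandermonde u v j l) ⟩
      C r (M ℕ.+ l) * (C u j * C (u - + j + v) l)
        ≡⟨ cong (λ t → C r (M ℕ.+ l) * (C u j * t))
             (trans (cong (λ t → C t l) (top (+ M) r s (+ j) (+ l))) (sym (C-symmetric M l))) ⟩
      C r (M ℕ.+ l) * (C u j * C (+ (M ℕ.+ l)) M)
        ≡⟨ reassociate (C r (M ℕ.+ l)) _ (C r M) _ (trinomial-revision r M l) (C u j) ⟩
      C r M * (C u j * C (r - + M) l)
        ≡⟨ cong (λ t → C r M * (C u j * C (r - + M) t)) (ℕ.m+n∸m≡n j l) ⟨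
      C r M * (C u j * C (r - + M) (j ℕ.+ l ∸ j)) ∎

  -- A power series evaluation of ∑ 2^b C(2q - b, q) C(2y - 2q + b, b).

  -- The coefficients of (1 − 2t)^(−u−1) and of (1 − t)^(−v−1).
  P : ℤ → ℕ → ℤ
  P u b = (+ 2) ^ b * C (u + + b) b

  G : ℕ → ℕ → ℤ
  G v l = C (+ (v ℕ.+ l)) v

  -- At n = v = q and u = 2y - 2q this is the sum just named, since G q (q - b) = C(2q - b, q).
  H : ℤ → ℕ → ℕ → ℤ
  H u v = P u ⋆ G v

  P-step : ∀ u b → P (1ℤ + u) (suc b) ≡ P u (suc b) + + 2 * P (1ℤ + u) b
  P-step u b = begin
    + 2 * t * C (1ℤ + u + + suc b) (suc b)
      ≡⟨ *-congˡ (+ 2 * t) (trans (cong (λ x → C x (suc b)) (+-assoc 1ℤ u (+ suc b))) (pascal (u + + suc b) b)) ⟩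
    + 2 * t * (C (u + + suc b) (suc b) + C (u + (1ℤ + + b)) b)
      ≡⟨ cong (λ x → + 2 * t * (C (u + + suc b) (suc b) + C x b)) (shuffle u (+ b)) ⟩
    + 2 * t * (C (u + + suc b) (suc b) + C (1ℤ + u + + b) b)
      ≡⟨ expand (+ 2) t (C (u + + suc b) (suc b)) (C (1ℤ + u + + b) b) ⟩
    P u (suc b) + + 2 * P (1ℤ + u) b ∎
    where
    t = (+ 2) ^ b
    shuffle : ∀ u b → u + (1ℤ + b) ≡ 1ℤ + u + b
    shuffle = solve-∀
    expand : ∀ s t a b → s * t * (a + b) ≡ s * t * a + s * (t * b)
    expand = solve-∀

  G-0 : ∀ v → G v 0 ≡ 1ℤ
  G-0 v rewrite ℕ.+-identityʳ v = C-diagonal v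

  G-step : ∀ v l → G (suc v) (suc l) ≡ G v (suc l) + G (suc v) l
  G-step v l = begin
    C (+ (v ℕ.+ suc l)) (suc v) + C (+ (v ℕ.+ suc l)) v   ≡⟨ +-comm _ (C (+ (v ℕ.+ suc l)) v) ⟩
    C (+ (v ℕ.+ suc l)) v + C (+ (v ℕ.+ suc l)) (suc v)   ≡⟨ cong (λ t → G v (suc l) + C (+ t) (suc v)) (ℕ.+-suc v l) ⟩
    G v (suc l) + G (suc v) l                             ∎

  H-0 : ∀ u v → H u v 0 ≡ 1ℤ
  H-0 u v = trans (*-identityˡ (G v 0)) (G-0 v)

  -- Multiplication by 1 - 2t lowers u by one; likewise, in `H-stepʳ`, multiplication by 1 - t
  -- lowers v by one.
  H-stepˡ : ∀ u v n → H (1ℤ + u) v (suc n) ≡ H u v (suc n) + + 2 * H (1ℤ + u) v n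
  H-stepˡ u v = ⋆-stepˡ (+ 2) (P (1ℤ + u)) (P u) (P (1ℤ + u)) (G v) refl (P-step u)

  H-stepʳ : ∀ u v n → H u (suc v) (suc n) ≡ H u v (suc n) + H u (suc v) n
  H-stepʳ u v = ⋆-stepʳ (P u) (G (suc v)) (G v) (trans (G-0 (suc v)) (sym (G-0 v))) (G-step v)

  -- This is 1 − (1 − 2t)² = 4t(1 − t).
  H-step : ∀ u v n → H (1ℤ + (1ℤ + u)) (suc v) (suc n) ≡ H u (suc v) (suc n) + + 4 * H (1ℤ + (1ℤ + u)) v n
  H-step u v n = begin
    H (1ℤ + (1ℤ + u)) (suc v) (suc n)
      ≡⟨ H-stepˡ (1ℤ + u) (suc v) n ⟩
    H (1ℤ + u) (suc v) (suc n) + + 2 * a n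
      ≡⟨ +-congʳ (+ 2 * a n) (H-stepˡ u (suc v) n) ⟩
    H u (suc v) (suc n) + + 2 * H (1ℤ + u) (suc v) n + + 2 * a n
      ≡⟨ +-assoc (H u (suc v) (suc n)) (+ 2 * H (1ℤ + u) (suc v) n) (+ 2 * a n) ⟩
    H u (suc v) (suc n) + (+ 2 * H (1ℤ + u) (suc v) n + + 2 * a n)
      ≡⟨ +-congˡ (H u (suc v) (suc n)) (quadruple n) ⟩
    H u (suc v) (suc n) + + 4 * H (1ℤ + (1ℤ + u)) v n ∎
    where
    a : ℕ → ℤ
    a = H (1ℤ + (1ℤ + u)) (suc v)
    solution : ∀ x y z w → x ≡ y + + 2 * z → x ≡ w + z → + 2 * y + + 2 * x ≡ + 4 * w
    solution x y z w e₁ e₂ = begin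
      + 2 * y + + 2 * x                                     ≡⟨ rewrite₁ x y z ⟩
      + 4 * x + + 2 * (y + + 2 * z) - + 2 * x - + 4 * z     ≡⟨ cong (λ t → + 4 * x + + 2 * t - + 2 * x - + 4 * z) e₁ ⟨
      + 4 * x + + 2 * x - + 2 * x - + 4 * z                 ≡⟨ cong (λ t → + 4 * t + + 2 * x - + 2 * x - + 4 * z) e₂ ⟩
      + 4 * (w + z) + + 2 * x - + 2 * x - + 4 * z           ≡⟨ rewrite₂ x w z ⟩
      + 4 * w                                               ∎
      where
      rewrite₁ : ∀ x y z → + 2 * y + + 2 * x ≡ + 4 * x + + 2 * (y + + 2 * z) - + 2 * x - + 4 * z
      rewrite₁ = solve-∀
      rewrite₂ : ∀ x w z → + 4 * (w + z) + + 2 * x - + 2 * x - + 4 * z ≡ + 4 * w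
      rewrite₂ = solve-∀
    -- With A the generating function of `a`, this is 2 (1 - 2t) A + 2 A = 4 (1 - t) A.
    quadruple : ∀ n → + 2 * H (1ℤ + u) (suc v) n + + 2 * a n ≡ + 4 * H (1ℤ + (1ℤ + u)) v n
    quadruple zero = trans (cong₂ (λ x y → + 2 * x + + 2 * y) (H-0 (1ℤ + u) (suc v)) (H-0 (1ℤ + (1ℤ + u)) (suc v)))
                           (cong (+ 4 *_) (sym (H-0 (1ℤ + (1ℤ + u)) v)))
    quadruple (suc n) = solution (a (suc n)) (H (1ℤ + u) (suc v) (suc n)) (a n) (H (1ℤ + (1ℤ + u)) v (suc n))
      (H-stepˡ (1ℤ + u) (suc v) n) (H-stepʳ (1ℤ + (1ℤ + u)) v n)

  -- This is ∑ 2^b C(2q - b, q) = 4^q. Put X = H 0 (q + 1) (q + 1) and A = H 0 (q + 1) q. Splitting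
  -- off 1 - 2t gives X = C(2q + 2, q + 1) + 2 A; splitting off 1 - t and then 1 - 2t gives X = C(2q
  -- + 1, q) + 2 H 0 q q + A. As C(2q + 2, q + 1) = 2 C(2q + 1, q), twice the second minus the first
  -- leaves X = 4 H 0 q q.
  H-central : ∀ q → H 0ℤ q q ≡ (+ 4) ^ q
  H-central zero    = refl
  H-central (suc q) = solution (H 0ℤ (suc q) (suc q)) (G q (suc q)) (H 0ℤ (suc q) q) (H 0ℤ q q)
    (trans (powers (suc q) q) (+-congʳ (+ 2 * H 0ℤ (suc q) q) double))
    (trans (H-stepʳ 0ℤ q q) (+-congʳ (H 0ℤ (suc q) q) (powers q q)))
    (H-central q)
    where
    P-δ : ∀ b → P 0ℤ (suc b) ≡ δ (suc b) + + 2 * P 0ℤ b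
    P-δ b = begin
      + 2 * (+ 2) ^ b * C (+ suc b) (suc b)   ≡⟨ *-congˡ (+ 2 * (+ 2) ^ b) (trans (C-diagonal (suc b)) (sym (C-diagonal b))) ⟩
      + 2 * (+ 2) ^ b * C (+ b) b             ≡⟨ *-assoc (+ 2) ((+ 2) ^ b) (C (+ b) b) ⟩
      + 2 * P 0ℤ b                          ≡⟨ +-identityˡ _ ⟨
      0ℤ + + 2 * P 0ℤ b                     ∎
    powers : ∀ v n → H 0ℤ v (suc n) ≡ G v (suc n) + + 2 * H 0ℤ v n
    powers v n = trans (⋆-stepˡ (+ 2) (P 0ℤ) δ (P 0ℤ) (G v) refl P-δ n)
                       (+-congʳ (+ 2 * H 0ℤ v n) (⋆-identityˡ (G v) (suc n)))
    double : G (suc q) (suc q) ≡ + 2 * G q (suc q)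
    double = begin
      C (+ (q ℕ.+ suc q)) (suc q) + C (+ (q ℕ.+ suc q)) q   ≡⟨ +-congʳ (G q (suc q)) (C-symmetric q (suc q)) ⟨
      G q (suc q) + G q (suc q)                             ≡⟨ twice (G q (suc q)) ⟩
      + 2 * G q (suc q)                                     ∎
      where
      twice : ∀ x → x + x ≡ + 2 * x
      twice = solve-∀
    solution : ∀ x c a y → x ≡ + 2 * c + + 2 * a → x ≡ c + + 2 * y + a → ∀ {z} → y ≡ z → x ≡ + 4 * z
    solution x c a y e₁ e₂ refl = begin
      x                                          ≡⟨ rewrite₁ x ⟩
      + 2 * x - x                                ≡⟨ cong₂ (λ s t → + 2 * s - t) e₂ e₁ ⟩
      + 2 * (c + + 2 * y + a) - (+ 2 * c + + 2 * a)  ≡⟨ rewrite₂ c a y ⟩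
      + 4 * y                                    ∎
      where
      rewrite₁ : ∀ x → x ≡ + 2 * x - x
      rewrite₁ = solve-∀
      rewrite₂ : ∀ c a y → + 2 * (c + + 2 * y + a) - (+ 2 * c + + 2 * a) ≡ + 4 * y
      rewrite₂ = solve-∀

  -- Both sides have the same increments in y, and they agree at y = q.
  H-diagonal : ∀ q y → H (+ 2 * + y - + 2 * + q) q q ≡ (+ 4) ^ q * C (+ y) q
  H-diagonal zero    y = refl
  H-diagonal (suc q) y = agree (trans (constant y) (trans (sym (constant (suc q))) agree-base))
    where
    u : ℕ → ℤ
    u y = + 2 * + y - + 2 * + suc q
    D : ℕ → ℤ
    D y = H (u y) (suc q) (suc q) - (+ 4) ^ suc q * C (+ y) (suc q)
    increment : ∀ y q → + 2 * (1ℤ + y) - + 2 * (1ℤ + q) ≡ 1ℤ + (1ℤ + (+ 2 * y - + 2 * (1ℤ + q)))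
    increment = solve-∀
    increment′ : ∀ y q → 1ℤ + (1ℤ + (+ 2 * y - + 2 * (1ℤ + q))) ≡ + 2 * y - + 2 * q
    increment′ = solve-∀
    cancel : ∀ h f a b → h + + 4 * (f * a) - + 4 * f * (b + a) ≡ h - + 4 * f * b
    cancel = solve-∀
    step : ∀ y → D (suc y) ≡ D y
    step y = begin
      H (u (suc y)) (suc q) (suc q) - (+ 4) ^ suc q * C (+ suc y) (suc q)
        ≡⟨ cong (λ t → H t (suc q) (suc q) - (+ 4) ^ suc q * C (+ suc y) (suc q)) (increment (+ y) (+ q)) ⟩
      H (1ℤ + (1ℤ + u y)) (suc q) (suc q) - (+ 4) ^ suc q * C (+ suc y) (suc q)
        ≡⟨ cong (_- (+ 4) ^ suc q * C (+ suc y) (suc q)) (trans (H-step (u y) q q)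
             (cong (λ t → H (u y) (suc q) (suc q) + + 4 * t)
               (trans (cong (λ t → H t q q) (increment′ (+ y) (+ q))) (H-diagonal q y)))) ⟩
      H (u y) (suc q) (suc q) + + 4 * ((+ 4) ^ q * C (+ y) q) - + 4 * (+ 4) ^ q * (C (+ y) (suc q) + C (+ y) q)
        ≡⟨ cancel (H (u y) (suc q) (suc q)) ((+ 4) ^ q) (C (+ y) q) (C (+ y) (suc q)) ⟩
      D y ∎
    constant : ∀ y → D y ≡ D 0
    constant zero    = refl
    constant (suc y) = trans (step y) (constant y)
    agree-base : D (suc q) ≡ 0ℤ
    agree-base = begin
      H (u (suc q)) (suc q) (suc q) - (+ 4) ^ suc q * C (+ suc q) (suc q)
        ≡⟨ cong₂ (λ s t → H s (suc q) (suc q) - (+ 4) ^ suc q * t) (+-inverseʳ (+ 2 * + suc q)) (C-diagonal (suc q)) ⟩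
      H 0ℤ (suc q) (suc q) - (+ 4) ^ suc q * 1ℤ
        ≡⟨ cong₂ _-_ (H-central (suc q)) (*-identityʳ ((+ 4) ^ suc q)) ⟩
      (+ 4) ^ suc q - (+ 4) ^ suc q
        ≡⟨ +-inverseʳ ((+ 4) ^ suc q) ⟩
      0ℤ ∎
    agree : ∀ {a b} → a - b ≡ 0ℤ → a ≡ b
    agree {a} {b} = i-j≡0⇒i≡j a b

  -- Associated Stirling numbers and the rook numbers of a staircase.

  -- Blocks of size at least two need 2r points. In `E-step` this removes the term p = j + 1.
  assocStirling₂-vanish : ∀ n r → n ℕ.< r ℕ.+ r → assocStirling₂ n r ≡ 0
  assocStirling₂-vanish zero          (suc r) _ = refl
  assocStirling₂-vanish (suc zero)    r       _ = refl
  assocStirling₂-vanish (suc (suc n)) (suc r) lt = cong₂ ℕ._+_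
    (trans (cong (suc r ℕ.*_) (assocStirling₂-vanish (suc n) (suc r) (ℕ.<-trans (ℕ.n<1+n _) lt))) (ℕ.*-zeroʳ (suc r)))
    (trans (cong (suc n ℕ.*_) (assocStirling₂-vanish n r (ℕ.s≤s⁻¹ (ℕ.≤-trans (ℕ.s≤s⁻¹ lt) (ℕ.≤-reflexive (ℕ.+-suc r r))))))
           (ℕ.*-zeroʳ (suc n)))

  assocStirling₂-zero : ∀ n → assocStirling₂ (suc n) 0 ≡ 0
  assocStirling₂-zero zero    = refl
  assocStirling₂-zero (suc n) = refl

  -- For n ∈ ℕ this is the Stirling number of the second kind {n, n − j}: p counts the
  -- non-singleton blocks.
  E : ℤ → ℕ → ℤ
  E n j = sumTo j λ p → + assocStirling₂ (p ℕ.+ j) p * C n (p ℕ.+ j)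

  -- For n ∈ ℕ this is {n + 1, n - j} = {n, n - j - 1} + (n - j) {n, n - j}. Once Pascal's rule has
  -- split off E n (j + 1), the recurrence of `assocStirling₂` breaks the rest into p t(p) and, by
  -- absorption, (n - p - j) t(p); these add up to (n - j) t(p).
  E-step : ∀ n j → E (1ℤ + n) (suc j) ≡ E n (suc j) + (n - + j) * E n j
  E-step n j = begin
    sumTo (suc j) (λ p → a′ p * C (1ℤ + n) (p ℕ.+ suc j))
      ≡⟨ sumTo-cong (suc j) split ⟩
    sumTo (suc j) (λ p → a′ p * C n (p ℕ.+ suc j) + a′ p * C n (p ℕ.+ j))
      ≡⟨ sumTo-+ (suc j) (λ p → a′ p * C n (p ℕ.+ suc j)) _ ⟩
    E n (suc j) + sumTo (suc j) (λ p → a′ p * C n (p ℕ.+ j))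
      ≡⟨ +-congˡ (E n (suc j)) (begin
           sumTo (suc j) (λ p → a′ p * C n (p ℕ.+ j))
             ≡⟨ sumTo-head j (λ p → a′ p * C n (p ℕ.+ j)) ⟩
           a′ 0 * C n j + sumTo j (λ p → a′ (suc p) * C n (suc (p ℕ.+ j)))
             ≡⟨ trans (+-congʳ (sumTo j λ p → a′ (suc p) * C n (suc (p ℕ.+ j)))
                  (trans (*-congʳ (C n j) (cong +_ (assocStirling₂-zero j))) (*-zeroˡ (C n j)))) (+-identityˡ _) ⟩
           sumTo j (λ p → a′ (suc p) * C n (suc (p ℕ.+ j)))
             ≡⟨ sumTo-cong j recurrence ⟩
           sumTo j (λ p → b (suc p) + (n - + (p ℕ.+ j)) * t p)
             ≡⟨ sumTo-+ j (b ∘ suc) _ ⟩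
           sumTo j (b ∘ suc) + sumTo j (λ p → (n - + (p ℕ.+ j)) * t p)
             ≡⟨ +-congʳ (sumTo j (λ p → (n - + (p ℕ.+ j)) * t p)) reindex ⟩
           sumTo j b + sumTo j (λ p → (n - + (p ℕ.+ j)) * t p)
             ≡⟨ sumTo-+ j b _ ⟨
           sumTo j (λ p → b p + (n - + (p ℕ.+ j)) * t p)
             ≡⟨ sumTo-cong j (λ p → combine (+ p) (+ j) n (t p)) ⟩
           sumTo j (λ p → (n - + j) * t p)
             ≡⟨ sumTo-*ˡ j (n - + j) t ⟩
           (n - + j) * E n j ∎) ⟩
    E n (suc j) + (n - + j) * E n j ∎
    where
    a′ t b : ℕ → ℤ
    a′ p = + assocStirling₂ (p ℕ.+ suc j) p
    t p = + assocStirling₂ (p ℕ.+ j) p * C n (p ℕ.+ j)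
    b p = + p * t p
    combine : ∀ p j n t → p * t + (n - (p + j)) * t ≡ (n - j) * t
    combine = solve-∀
    split : ∀ p → a′ p * C (1ℤ + n) (p ℕ.+ suc j) ≡ a′ p * C n (p ℕ.+ suc j) + a′ p * C n (p ℕ.+ j)
    split p rewrite ℕ.+-suc p j = trans (cong (x *_) (pascal n (p ℕ.+ j))) (*-distribˡ-+ x (C n (suc (p ℕ.+ j))) (C n (p ℕ.+ j)))
      where x = + assocStirling₂ (suc (p ℕ.+ j)) p
    recurrence : ∀ p → a′ (suc p) * C n (suc (p ℕ.+ j)) ≡ b (suc p) + (n - + (p ℕ.+ j)) * t p
    recurrence p = begin
      + assocStirling₂ (suc (p ℕ.+ suc j)) (suc p) * c
        ≡⟨ cong (λ s → + assocStirling₂ (suc s) (suc p) * c) (ℕ.+-suc p j) ⟩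
      + (suc p ℕ.* x ℕ.+ suc (p ℕ.+ j) ℕ.* y) * c
        ≡⟨ cong (_* c) (cong₂ _+_ (pos-* (suc p) x) (pos-* (suc (p ℕ.+ j)) y)) ⟩
      (+ suc p * + x + + suc (p ℕ.+ j) * + y) * c
        ≡⟨ expand (+ suc p) (+ x) (+ suc (p ℕ.+ j)) (+ y) c ⟩
      + suc p * (+ x * c) + + y * (+ suc (p ℕ.+ j) * c)
        ≡⟨ cong (λ s → + suc p * (+ x * c) + + y * s) (absorption n (p ℕ.+ j)) ⟩
      + suc p * (+ x * c) + + y * ((n - + (p ℕ.+ j)) * C n (p ℕ.+ j))
        ≡⟨ +-congˡ (+ suc p * (+ x * c)) (exchange (+ y) (n - + (p ℕ.+ j)) (C n (p ℕ.+ j))) ⟩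
      b (suc p) + (n - + (p ℕ.+ j)) * t p ∎
      where
      c = C n (suc (p ℕ.+ j))
      x = assocStirling₂ (suc (p ℕ.+ j)) (suc p)
      y = assocStirling₂ (p ℕ.+ j) p
      expand : ∀ p x q y c → (p * x + q * y) * c ≡ p * (x * c) + y * (q * c)
      expand = solve-∀
      exchange : ∀ a b c → a * (b * c) ≡ b * (a * c)
      exchange = solve-∀
    -- `b` carries the factor p, so p = 0 adds nothing, and b (j + 1) vanishes because 2j + 1 points
    -- cannot fill j + 1 blocks.
    reindex : sumTo j (b ∘ suc) ≡ sumTo j b
    reindex = begin
      sumTo j (b ∘ suc)          ≡⟨ +-identityˡ _ ⟨
      0ℤ + sumTo j (b ∘ suc)     ≡⟨ +-congʳ (sumTo j (b ∘ suc)) (*-zeroˡ (t 0)) ⟨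
      b 0 + sumTo j (b ∘ suc)    ≡⟨ sumTo-head j b ⟨
      sumTo j b + b (suc j)      ≡⟨ +-congˡ (sumTo j b) (trans (cong (λ s → + suc j * (+ s * C n (suc j ℕ.+ j)))
                                      (assocStirling₂-vanish (suc j ℕ.+ j) (suc j) (ℕ.s≤s (ℕ.≤-reflexive (sym (ℕ.+-suc j j))))))
                                      (vanish (+ suc j) (C n (suc j ℕ.+ j)))) ⟩
      sumTo j b + 0ℤ             ≡⟨ +-identityʳ _ ⟩
      sumTo j b                  ∎
      where
      vanish : ∀ a b → a * (0ℤ * b) ≡ 0ℤ
      vanish = solve-∀

  -- For naturals y ≤ n, the number of ways to place k non-attacking rooks on a Ferrers board
  -- with n rows obtained from the staircase 0, 1, …, n − 1 by adding one cell to y of its rows.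
  F : ℤ → ℤ → ℕ → ℤ
  F n y k = sumTo k λ j → C y (k ∸ j) * E (n - + (k ∸ j)) j

  -- A new row of n cells has n - k left by k rooks. The shift in E (n - (k - j)) j is what makes
  -- the formula fit: the factor from `E-step` is n - (k - j) - j = n - k, the same for every j.
  F-step : ∀ n y k → F (1ℤ + n) y (suc k) ≡ F n y (suc k) + (n - + k) * F n y k
  F-step n y k = begin
    F (1ℤ + n) y (suc k)
      ≡⟨ sumTo-head k (λ j → C y (suc k ∸ j) * E (1ℤ + n - + (suc k ∸ j)) j) ⟩
    C y (suc k) * 1ℤ + sumTo k (λ j → C y (k ∸ j) * E (1ℤ + n - + (k ∸ j)) (suc j))
      ≡⟨ +-congˡ (C y (suc k) * 1ℤ) (trans (sumTo-cong≤ k step) (trans (sumTo-+ k tail _)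
           (+-congˡ (sumTo k tail) (sumTo-*ˡ k (n - + k) _)))) ⟩
    C y (suc k) * 1ℤ + (sumTo k tail + (n - + k) * F n y k)
      ≡⟨ +-assoc (C y (suc k) * 1ℤ) (sumTo k tail) ((n - + k) * F n y k) ⟨
    C y (suc k) * 1ℤ + sumTo k tail + (n - + k) * F n y k
      ≡⟨ +-congʳ ((n - + k) * F n y k) (sumTo-head k (λ j → C y (suc k ∸ j) * E (n - + (suc k ∸ j)) j)) ⟨
    F n y (suc k) + (n - + k) * F n y k ∎
    where
    tail : ℕ → ℤ
    tail j = C y (k ∸ j) * E (n - + (k ∸ j)) (suc j)
    expand : ∀ c e k e′ → c * (e + k * e′) ≡ c * e + k * (c * e′)
    expand = solve-∀
    regroup : ∀ n q j → n - q - j ≡ n - (j + q)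
    regroup = solve-∀
    step : ∀ j → j ℕ.≤ k → C y (k ∸ j) * E (1ℤ + n - + (k ∸ j)) (suc j)
                          ≡ tail j + (n - + k) * (C y (k ∸ j) * E (n - + (k ∸ j)) j)
    step j j≤k = begin
      C y (k ∸ j) * E (1ℤ + n - + (k ∸ j)) (suc j)
        ≡⟨ *-congˡ (C y (k ∸ j)) (trans (cong (λ t → E t (suc j)) (+-assoc 1ℤ n (- + (k ∸ j)))) (E-step (n - + (k ∸ j)) j)) ⟩
      C y (k ∸ j) * (E (n - + (k ∸ j)) (suc j) + (n - + (k ∸ j) - + j) * E (n - + (k ∸ j)) j)
        ≡⟨ cong (λ t → C y (k ∸ j) * (E (n - + (k ∸ j)) (suc j) + t * E (n - + (k ∸ j)) j))
             (trans (regroup n (+ (k ∸ j)) (+ j)) (cong (λ t → n - + t) (ℕ.m+[n∸m]≡n j≤k))) ⟩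
      C y (k ∸ j) * (E (n - + (k ∸ j)) (suc j) + (n - + k) * E (n - + (k ∸ j)) j)
        ≡⟨ expand (C y (k ∸ j)) (E (n - + (k ∸ j)) (suc j)) (n - + k) (E (n - + (k ∸ j)) j) ⟩
      tail j + (n - + k) * (C y (k ∸ j) * E (n - + (k ∸ j)) j) ∎

  -- On a board, take the extra cell of the longest row that has one: it is empty, or it holds a
  -- rook and its row and column disappear. In the formula, Pascal's rule in y lowers k - j by one,
  -- which offsets the smaller n because (1 + n) - (1 + q) = n - q.
  F-pascal : ∀ n y k → F (1ℤ + n) (1ℤ + y) (suc k) ≡ F (1ℤ + n) y (suc k) + F n y k
  F-pascal n y k = begin
    sumTo k (λ j → C (1ℤ + y) (suc k ∸ j) * e j) + C (1ℤ + y) (k ∸ k) * e (suc k)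
      ≡⟨ cong₂ _+_ (trans (sumTo-cong≤ k step) (sumTo-+ k (λ j → C y (suc k ∸ j) * e j) _))
                   (*-congʳ (e (suc k)) (trans (cong (C (1ℤ + y)) (ℕ.n∸n≡0 k)) (cong (C y) (sym (ℕ.n∸n≡0 k))))) ⟩
    sumTo k (λ j → C y (suc k ∸ j) * e j) + F n y k + C y (k ∸ k) * e (suc k)
      ≡⟨ rotate (sumTo k (λ j → C y (suc k ∸ j) * e j)) (F n y k) (C y (k ∸ k) * e (suc k)) ⟩
    F (1ℤ + n) y (suc k) + F n y k ∎
    where
    e : ℕ → ℤ
    e j = E (1ℤ + n - + (suc k ∸ j)) j
    rotate : ∀ a b c → a + b + c ≡ a + c + b
    rotate = solve-∀
    cancel : ∀ n q → 1ℤ + n - (1ℤ + q) ≡ n - q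
    cancel = solve-∀
    step : ∀ j → j ℕ.≤ k → C (1ℤ + y) (suc k ∸ j) * e j ≡ C y (suc k ∸ j) * e j + C y (k ∸ j) * E (n - + (k ∸ j)) j
    step j j≤k rewrite ℕ.+-∸-assoc 1 j≤k = begin
      C (1ℤ + y) (suc q) * E (1ℤ + n - + suc q) j
        ≡⟨ *-congʳ (E (1ℤ + n - + suc q) j) (pascal y q) ⟩
      (C y (suc q) + C y q) * E (1ℤ + n - + suc q) j
        ≡⟨ *-distribʳ-+ (E (1ℤ + n - + suc q) j) (C y (suc q)) (C y q) ⟩
      C y (suc q) * E (1ℤ + n - + suc q) j + C y q * E (1ℤ + n - + suc q) j
        ≡⟨ cong (λ t → C y (suc q) * E (1ℤ + n - + suc q) j + C y q * E t j) (cancel n (+ q)) ⟩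
      C y (suc q) * E (1ℤ + n - + suc q) j + C y q * E (n - + q) j ∎
      where q = k ∸ j

  -- A new row with its extra cell has n + 1 cells. Together with `F-step` this shows that only the
  -- number of extra cells matters, not which rows carry them.
  F-step′ : ∀ n y k → F (1ℤ + n) (1ℤ + y) (suc k) ≡ F n y (suc k) + (1ℤ + n - + k) * F n y k
  F-step′ n y k = begin
    F (1ℤ + n) (1ℤ + y) (suc k)                               ≡⟨ F-pascal n y k ⟩
    F (1ℤ + n) y (suc k) + F n y k                            ≡⟨ +-congʳ (F n y k) (F-step n y k) ⟩
    F n y (suc k) + (n - + k) * F n y k + F n y k             ≡⟨ collect (F n y (suc k)) n (+ k) (F n y k) ⟩
    F n y (suc k) + (1ℤ + n - + k) * F n y k                  ∎
    where
    collect : ∀ a n k f → a + (n - k) * f + f ≡ a + (1ℤ + n - k) * f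
    collect = solve-∀

  -- C(0, k + 1 - j) leaves only j = k + 1, and E 0 (k + 1) vanishes because all its binomials have
  -- a positive lower index.
  F-0 : ∀ k → F 0ℤ 0ℤ (suc k) ≡ 0ℤ
  F-0 k = cong₂ _+_
    (sumTo-zero k λ j j≤k → trans (*-congʳ (E (0ℤ - + (suc k ∸ j)) j) (cong (C 0ℤ) (ℕ.+-∸-assoc 1 j≤k)))
                                  (*-zeroˡ (E (0ℤ - + (suc k ∸ j)) j)))
    (trans (cong (λ t → C 0ℤ t * E (0ℤ - + t) (suc k)) (ℕ.n∸n≡0 k))
      (trans (*-identityˡ _) (sumTo-zero (suc k) λ p _ →
        trans (cong (λ t → + assocStirling₂ (p ℕ.+ suc k) p * C 0ℤ t) (ℕ.+-suc p k)) (*-zeroʳ (+ assocStirling₂ (p ℕ.+ suc k) p)))))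

  -- Signed Stirling numbers and the sums over β.

  -- Multiplying the expansion for i by m - i reproduces the recurrence of `stirling₁`: the factor m
  -- raises d, the factor -i keeps it, and the sign (-1)^(i - d) absorbs the minus.
  signed-stirling₁ : ∀ m i → sumTo i (λ d → -1ℤ ^ (i ∸ d) * + stirling₁ i d * m ^ d) ≡ fallingFactorial m i
  signed-stirling₁ m zero    = refl
  signed-stirling₁ m (suc i) = begin
    sumTo (suc i) (λ d → -1ℤ ^ (suc i ∸ d) * + stirling₁ (suc i) d * m ^ d)
      ≡⟨ sumTo-head i (λ d → -1ℤ ^ (suc i ∸ d) * + stirling₁ (suc i) d * m ^ d) ⟩
    -1ℤ ^ suc i * 0ℤ * 1ℤ + sumTo i (λ d → -1ℤ ^ (i ∸ d) * + stirling₁ (suc i) (suc d) * (m * m ^ d))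
      ≡⟨ cong₂ _+_ (vanish (-1ℤ ^ suc i)) (trans (sumTo-cong i recurrence) (sumTo-+ i (g ∘ suc) _)) ⟩
    0ℤ + (sumTo i (g ∘ suc) + sumTo i (λ d → m * f d))
      ≡⟨ trans (+-identityˡ _) (cong₂ _+_ (trans reindex (trans (sumTo-cong≤ i sign) (sumTo-*ˡ i (- + i) f))) (sumTo-*ˡ i m f)) ⟩
    - + i * sumTo i f + m * sumTo i f
      ≡⟨ collect (+ i) m (sumTo i f) ⟩
    sumTo i f * (m - + i)
      ≡⟨ cong (_* (m - + i)) (signed-stirling₁ m i) ⟩
    fallingFactorial m i * (m - + i) ∎
    where
    f g : ℕ → ℤ
    f d = -1ℤ ^ (i ∸ d) * + stirling₁ i d * m ^ d
    g d = + i * (-1ℤ ^ (suc i ∸ d) * + stirling₁ i d * m ^ d)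
    vanish : ∀ a → a * 0ℤ * 1ℤ ≡ 0ℤ
    vanish = solve-∀
    collect : ∀ i m s → - i * s + m * s ≡ s * (m - i)
    collect = solve-∀
    recurrence : ∀ d → -1ℤ ^ (i ∸ d) * + stirling₁ (suc i) (suc d) * (m * m ^ d) ≡ g (suc d) + m * f d
    recurrence d = trans
      (cong (λ t → -1ℤ ^ (i ∸ d) * (t + + stirling₁ i d) * (m * m ^ d)) (pos-* i (stirling₁ i (suc d))))
      (expand (-1ℤ ^ (i ∸ d)) (+ i) (+ stirling₁ i (suc d)) (+ stirling₁ i d) m (m ^ d))
      where
      expand : ∀ s i x y m p → s * (i * x + y) * (m * p) ≡ i * (s * x * (m * p)) + m * (s * y * p)
      expand = solve-∀
    sign : ∀ d → d ℕ.≤ i → g d ≡ - + i * f d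
    sign d d≤i rewrite ℕ.+-∸-assoc 1 d≤i = negate (+ i) (-1ℤ ^ (i ∸ d)) (+ stirling₁ i d) (m ^ d)
      where
      negate : ∀ i s x p → i * (-1ℤ * s * x * p) ≡ - i * (s * x * p)
      negate = solve-∀
    stirling₁-vanish : ∀ {i d} → i ℕ.< d → stirling₁ i d ≡ 0
    stirling₁-vanish {zero}  {suc d} _ = refl
    stirling₁-vanish {suc i} {suc d} (ℕ.s≤s i<d) =
      cong₂ ℕ._+_ (trans (cong (i ℕ.*_) (stirling₁-vanish (ℕ.m<n⇒m<1+n i<d))) (ℕ.*-zeroʳ i)) (stirling₁-vanish i<d)
    -- For i = 0 the factor i vanishes, for i > 0 the number `stirling₁ i 0` does.
    g-first : ∀ i x → + i * (x * + stirling₁ i 0 * 1ℤ) ≡ 0ℤ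
    g-first zero    x = *-zeroˡ (x * 1ℤ * 1ℤ)
    g-first (suc i) x = vanish′ (+ suc i) x
      where
      vanish′ : ∀ i x → i * (x * 0ℤ * 1ℤ) ≡ 0ℤ
      vanish′ = solve-∀
    g-last : g (suc i) ≡ 0ℤ
    g-last = trans (cong (λ t → + i * (-1ℤ ^ (i ∸ i) * + t * (m * m ^ i))) (stirling₁-vanish (ℕ.n<1+n i)))
                   (vanish′ (+ i) (-1ℤ ^ (i ∸ i)) (m * m ^ i))
      where
      vanish′ : ∀ i x y → i * (x * 0ℤ * y) ≡ 0ℤ
      vanish′ = solve-∀
    reindex : sumTo i (g ∘ suc) ≡ sumTo i g
    reindex = begin
      sumTo i (g ∘ suc)          ≡⟨ +-identityˡ _ ⟨
      0ℤ + sumTo i (g ∘ suc)     ≡⟨ +-congʳ (sumTo i (g ∘ suc)) (g-first i (-1ℤ ^ suc i)) ⟨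
      g 0 + sumTo i (g ∘ suc)    ≡⟨ sumTo-head i g ⟨
      sumTo i g + g (suc i)      ≡⟨ +-congˡ (sumTo i g) g-last ⟩
      sumTo i g + 0ℤ             ≡⟨ +-identityʳ _ ⟩
      sumTo i g                  ∎

  -- 4^q βᵢ(p, q, z) is the sum of these over b from i ∸ p to q.
  βTerm : ℕ → ℕ → ℕ → ℤ → ℕ → ℤ
  βTerm i p q z b = (+ 2) ^ b * C (+ (2 ℕ.* q) - + b) q *
    sumTo b λ a → C (+ p + + b - + q - z) a * C (+ q + z) (b ∸ a) * C (+ a - + q) (p ℕ.+ b ∸ i)

  -- Only C(m, i) and C(a - q, p + b - i) depend on i, so Vandermonde turns the sum over i into C(m
  -- - q + a, p + b). The sum over a is then Riordan's, with M = p and n = b.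
  sum-βTerm : ∀ m p q z b → sumTo (p ℕ.+ b) (λ i → C (+ m) i * βTerm i p q z b)
    ≡ (+ 2) ^ b * C (+ (2 ℕ.* q) - + b) q * (C (+ m - + q) p * C (+ m + + b - + 2 * + q - z) b)
  sum-βTerm m p q z b = begin
    sumTo (p ℕ.+ b) (λ i → C (+ m) i * (B * sumTo b λ a → c a * C (+ a - + q) (p ℕ.+ b ∸ i)))
      ≡⟨ sumTo-cong (p ℕ.+ b) (λ i → trans (exchange (C (+ m) i) B (sumTo b λ a → c a * C (+ a - + q) (p ℕ.+ b ∸ i)))
           (*-congˡ B (trans (sym (sumTo-*ˡ b (C (+ m) i) λ a → c a * C (+ a - + q) (p ℕ.+ b ∸ i)))
             (sumTo-cong b λ a → exchange (C (+ m) i) (c a) (C (+ a - + q) (p ℕ.+ b ∸ i)))))) ⟩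
    sumTo (p ℕ.+ b) (λ i → B * sumTo b λ a → c a * (C (+ m) i * C (+ a - + q) (p ℕ.+ b ∸ i)))
      ≡⟨ sumTo-*ˡ (p ℕ.+ b) B (λ i → sumTo b λ a → c a * (C (+ m) i * C (+ a - + q) (p ℕ.+ b ∸ i))) ⟩
    B * sumTo (p ℕ.+ b) (λ i → sumTo b λ a → c a * (C (+ m) i * C (+ a - + q) (p ℕ.+ b ∸ i)))
      ≡⟨ *-congˡ B (sumTo-swap (p ℕ.+ b) b λ i a → c a * (C (+ m) i * C (+ a - + q) (p ℕ.+ b ∸ i))) ⟩
    B * sumTo b (λ a → sumTo (p ℕ.+ b) λ i → c a * (C (+ m) i * C (+ a - + q) (p ℕ.+ b ∸ i)))
      ≡⟨ *-congˡ B (sumTo-cong b λ a → trans (sumTo-*ˡ (p ℕ.+ b) (c a) λ i → C (+ m) i * C (+ a - + q) (p ℕ.+ b ∸ i))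
           (*-congˡ (c a) (trans (vandermonde (+ m) (+ a - + q) (p ℕ.+ b))
             (cong (λ t → C t (p ℕ.+ b)) (top₁ (+ m) (+ a) (+ q)))))) ⟩
    B * sumTo b (λ a → C (+ p + + b - + q - z) a * C (+ q + z) (b ∸ a) * C (r + + a) (p ℕ.+ b))
      ≡⟨ *-congˡ B (sumTo-cong b λ a → cong₂ (λ u v → C u a * C v (b ∸ a) * C (r + + a) (p ℕ.+ b))
           (top₂ (+ m) (+ p) (+ q) (+ b) z) (top₃ (+ m) (+ q) (+ b) z)) ⟩
    B * sumTo b (λ a → C (+ p - r + s) a * C (+ b + r - s) (b ∸ a) * C (r + + a) (p ℕ.+ b))
      ≡⟨ *-congˡ B (riordan r s p b) ⟩
    B * (C r p * C s b) ∎
    where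
    B = (+ 2) ^ b * C (+ (2 ℕ.* q) - + b) q
    -- Vandermonde fixes r; then s is forced by p - r + s = p + b - q - z, and b + r - s = q + z
    -- holds as well.
    r = + m - + q
    s = + m + + b - + 2 * + q - z
    c : ℕ → ℤ
    c a = C (+ p + + b - + q - z) a * C (+ q + z) (b ∸ a)
    exchange : ∀ a b c → a * (b * c) ≡ b * (a * c)
    exchange = solve-∀
    top₁ : ∀ m a q → m + (a - q) ≡ m - q + a
    top₁ = solve-∀
    top₂ : ∀ m p q b z → p + b - q - z ≡ p - (m - q) + (m + b - + 2 * q - z)
    top₂ = solve-∀
    top₃ : ∀ m q b z → q + z ≡ b + (m - q) - (m + b - + 2 * q - z)
    top₃ = solve-∀

  -- The hypothesis turns the upper argument m + b - 2q - z into 2y - 2q + b, so the sum over b is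
  -- C(m - q, p) times H (2y - 2q) q q.
  sum-sum-βTerm : ∀ m y p q z → + m - z ≡ + 2 * + y →
    sumTo q (λ b → sumTo (p ℕ.+ b) λ i → C (+ m) i * βTerm i p q z b)
    ≡ (+ 4) ^ q * (C (+ m - + q) p * C (+ y) q)
  sum-sum-βTerm m y p q z m-z≡2y = begin
    sumTo q (λ b → sumTo (p ℕ.+ b) λ i → C (+ m) i * βTerm i p q z b)
      ≡⟨ sumTo-cong≤ q (λ b b≤q → trans (sum-βTerm m p q z b) (term b b≤q)) ⟩
    sumTo q (λ b → C (+ m - + q) p * (P u b * G q (q ∸ b)))
      ≡⟨ sumTo-*ˡ q (C (+ m - + q) p) (λ b → P u b * G q (q ∸ b)) ⟩
    C (+ m - + q) p * H u q q
      ≡⟨ *-congˡ (C (+ m - + q) p) (H-diagonal q y) ⟩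
    C (+ m - + q) p * ((+ 4) ^ q * C (+ y) q)
      ≡⟨ exchange (C (+ m - + q) p) ((+ 4) ^ q) (C (+ y) q) ⟩
    (+ 4) ^ q * (C (+ m - + q) p * C (+ y) q) ∎
    where
    u = + 2 * + y - + 2 * + q
    exchange : ∀ a b c → a * (b * c) ≡ b * (a * c)
    exchange = solve-∀
    rearrange : ∀ t g c s → t * g * (c * s) ≡ c * (t * s * g)
    rearrange = solve-∀
    top : ∀ m z b q → m + b - + 2 * q - z ≡ m - z - + 2 * q + b
    top = solve-∀
    central : ∀ b → b ℕ.≤ q → + (2 ℕ.* q) - + b ≡ + (q ℕ.+ (q ∸ b))
    central b b≤q = begin
      + (2 ℕ.* q) - + b              ≡⟨ cong (λ t → + (q ℕ.+ t) - + b) (ℕ.+-identityʳ q) ⟩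
      + (q ℕ.+ q) - + b              ≡⟨ cong (λ t → + (q ℕ.+ t) - + b) (ℕ.m∸n+n≡m b≤q) ⟨
      + q + (+ (q ∸ b) + + b) - + b  ≡⟨ cancel (+ q) (+ (q ∸ b)) (+ b) ⟩
      + q + + (q ∸ b)                ∎
      where
      cancel : ∀ q r b → q + (r + b) - b ≡ q + r
      cancel = solve-∀
    term : ∀ b → b ℕ.≤ q →
      (+ 2) ^ b * C (+ (2 ℕ.* q) - + b) q * (C (+ m - + q) p * C (+ m + + b - + 2 * + q - z) b)
      ≡ C (+ m - + q) p * (P u b * G q (q ∸ b))
    term b b≤q = trans
      (cong₂ (λ s t → (+ 2) ^ b * C s q * (C (+ m - + q) p * C t b)) (central b b≤q)
        (trans (top (+ m) z (+ b) (+ q)) (cong (λ t → t - + 2 * + q + + b) m-z≡2y)))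
      (rearrange ((+ 2) ^ b) (G q (q ∸ b)) (C (+ m - + q) p) (C (u + + b) b))

  F-expand : ∀ n y k →
    sumTo k (λ j → sumTo j λ p → + assocStirling₂ (p ℕ.+ j) p * (C (n - + (k ∸ j)) (p ℕ.+ j) * C y (k ∸ j))) ≡ F n y k
  F-expand n y k = sumTo-cong k λ j → trans
    (sumTo-cong j λ p → rearrange (+ assocStirling₂ (p ℕ.+ j) p) (C (n - + (k ∸ j)) (p ℕ.+ j)) (C y (k ∸ j)))
    (sumTo-*ˡ j (C y (k ∸ j)) λ p → + assocStirling₂ (p ℕ.+ j) p * C (n - + (k ∸ j)) (p ℕ.+ j))
    where
    rearrange : ∀ a b c → a * (b * c) ≡ c * (a * b)
    rearrange = solve-∀

module BishopPlacements where
  open IntegerIdentities using (_⋆_; ⋆-stepˡ; sumTo-cong; ⋆-identityˡ; δ; F; F-0; F-step; F-step′)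
  open import Data.Integer.Base as ℤ using (ℤ; +_; _⊖_; 1ℤ)
  import Data.Integer.Properties as ℤ
  import Data.Integer.Tactic.RingSolver as ℤ
  open import Data.Bool.Base using (Bool; true; false)
  open import Data.List.Base using (List; []; _∷_; _++_; map; length; filter; applyUpTo)
  open import Data.Nat.ListAction using (sum)
  open import Data.List.Properties using (filter-++; filter-all; filter-none; filter-accept; filter-reject; filter-≐; length-map; length-++; length-applyUpTo)
  open import Data.List.Membership.Propositional using (_∈_)
  open import Data.List.Membership.Propositional.Properties using (∈-filter⁺; ∈-filter⁻; ∈-cartesianProduct⁺; ∈-cartesianProduct⁻; ∈-applyUpTo⁺; ∈-applyUpTo⁻; ∈-++⁻; ∈-++⁺ˡ; ∈-++⁺ʳ)
  open import Data.List.Membership.Propositional.Properties.WithK using (unique∧set⇒bag)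
  open import Data.List.Relation.Binary.BagAndSetEquality using (∼bag⇒↭)
  open import Data.List.Relation.Binary.Permutation.Propositional using (_↭_; prep; swap; ↭-sym) renaming (refl to ↭-refl; trans to _⟫_)
  open import Data.List.Relation.Binary.Permutation.Propositional.Properties using (filter-↭) renaming (shift to ↭-shift)
  open import Data.List.Relation.Unary.Any using (here; there)
  open import Data.List.Relation.Unary.All as All using (All; []; _∷_; all?)
  import Data.List.Relation.Unary.All.Properties as All
  open import Data.List.Relation.Unary.Unique.Propositional using (Unique; []; _∷_)
  import Data.List.Relation.Unary.Unique.Propositional.Properties as Unique
  open import Data.Nat.Base using (ℕ; zero; suc; _+_; _*_; _∸_; _≤_; _<_; z≤n; s≤s)
  open import Data.Nat.Divisibility using (_∣_; divides; ∣m+n∣m⇒∣n; ∣m∣n⇒∣m+n)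
  open import Data.Nat.Properties
  open import Data.Nat.Tactic.RingSolver using (solve-∀)
  open import Data.Product.Base using (_×_; _,_; proj₁; proj₂; ∃)
  open import Data.Sum.Base using (_⊎_; inj₁; inj₂)
  open import Function.Base using (_∘_; case_of_)
  open import Function.Bundles using (mk⇔)
  open import Relation.Binary.PropositionalEquality
  open import Relation.Binary.Definitions using (tri<; tri≈; tri>)
  open import Relation.Nullary.Decidable using (Dec; yes; no; ¬?)
  open import Relation.Nullary.Negation using (¬_; contradiction)
  open import Relation.Unary using (Pred; Decidable)
  open import Level using (0ℓ)
  open ≡-Reasoning

  -- Filtered lists and their sublists of a given size.

  module _ {A : Set} where

    filter-comm : ∀ {P Q : Pred A 0ℓ} (P? : Decidable P) (Q? : Decidable Q) xs →
                  filter P? (filter Q? xs) ≡ filter Q? (filter P? xs)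
    filter-comm P? Q? [] = refl
    filter-comm P? Q? (x ∷ xs) with P? x | Q? x
    ... | yes px | yes qx = trans (filter-accept P? px) (trans (cong (x ∷_) (filter-comm P? Q? xs)) (sym (filter-accept Q? qx)))
    ... | yes px | no ¬qx = trans (filter-comm P? Q? xs) (sym (filter-reject Q? ¬qx))
    ... | no ¬px | yes qx = trans (filter-reject P? ¬px) (filter-comm P? Q? xs)
    ... | no ¬px | no ¬qx = filter-comm P? Q? xs

    filter-∷-map : ∀ {P : Pred (List A) 0ℓ} (P? : Decidable P) x xss →
                   filter P? (map (x ∷_) xss) ≡ map (x ∷_) (filter (P? ∘ (x ∷_)) xss)
    filter-∷-map P? x [] = refl
    filter-∷-map P? x (xs ∷ xss) with P? (x ∷ xs)
    ... | yes _ = cong ((x ∷ xs) ∷_) (filter-∷-map P? x xss)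
    ... | no _  = filter-∷-map P? x xss

    filter-× : ∀ {P Q R : Pred A 0ℓ} (P? : Decidable P) (Q? : Decidable Q) (R? : Decidable R) {xs} →
               All (λ x → (P x → Q x × R x) × (Q x → R x → P x)) xs →
               filter P? xs ≡ filter R? (filter Q? xs)
    filter-× P? Q? R? [] = refl
    filter-× P? Q? R? {x ∷ xs} ((to , from) ∷ eqs) with P? x | Q? x
    ... | yes px | yes qx = trans (cong (x ∷_) (filter-× P? Q? R? eqs)) (sym (filter-accept R? (proj₂ (to px))))
    ... | yes px | no ¬qx = contradiction (proj₁ (to px)) ¬qx
    ... | no ¬px | yes qx = trans (filter-× P? Q? R? eqs) (sym (filter-reject R? (¬px ∘ from qx)))
    ... | no ¬px | no ¬qx = filter-× P? Q? R? eqs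

    filter-partition : ∀ {P : Pred A 0ℓ} (P? : Decidable P) xs →
                       xs ↭ filter P? xs ++ filter (¬? ∘ P?) xs
    filter-partition P? [] = ↭-refl
    filter-partition P? (x ∷ xs) with P? x
    ... | yes _ = prep x (filter-partition P? xs)
    ... | no _  = prep x (filter-partition P? xs) ⟫ ↭-sym (↭-shift x (filter P? xs) _)

    subsetsOfSize-filter : ∀ {P : Pred A 0ℓ} (P? : Decidable P) k xs →
                           subsetsOfSize k (filter P? xs) ≡ filter (all? P?) (subsetsOfSize k xs)
    subsetsOfSize-filter P? zero    xs = refl
    subsetsOfSize-filter P? (suc k) [] = refl
    subsetsOfSize-filter {P} P? (suc k) (x ∷ xs) = sym (begin
      filter (all? P?) (map (x ∷_) S ++ subsetsOfSize (suc k) xs)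
        ≡⟨ filter-++ (all? P?) (map (x ∷_) S) _ ⟩
      filter (all? P?) (map (x ∷_) S) ++ filter (all? P?) (subsetsOfSize (suc k) xs)
        ≡⟨ cong₂ _++_ (filter-∷-map (all? P?) x S) (sym (subsetsOfSize-filter P? (suc k) xs)) ⟩
      map (x ∷_) (filter (all? P? ∘ (x ∷_)) S) ++ subsetsOfSize (suc k) (filter P? xs)
        ≡⟨ tail (P? x) ⟩
      subsetsOfSize (suc k) (filter P? (x ∷ xs)) ∎)
      where
      S = subsetsOfSize k xs
      rest = subsetsOfSize (suc k) (filter P? xs)
      tail : Dec (P x) → map (x ∷_) (filter (all? P? ∘ (x ∷_)) S) ++ rest ≡ subsetsOfSize (suc k) (filter P? (x ∷ xs))
      tail (yes px) = trans
        (cong (λ T → map (x ∷_) T ++ rest)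
          (trans (filter-≐ (all? P? ∘ (x ∷_)) (all? P?) (All.tail , (px ∷_)) S) (sym (subsetsOfSize-filter P? k xs))))
        (cong (subsetsOfSize (suc k)) (sym (filter-accept P? px)))
      tail (no ¬px) = trans
        (cong (λ T → map (x ∷_) T ++ rest)
          (filter-none (all? P? ∘ (x ∷_)) {S} (All.universal (λ T → ¬px ∘ All.head) S)))
        (cong (subsetsOfSize (suc k)) (sym (filter-reject P? ¬px)))

    subsetsOfSize-All : ∀ {P : Pred A 0ℓ} k {xs} → All P xs → All (All P) (subsetsOfSize k xs)
    subsetsOfSize-All zero    pxs        = [] ∷ []
    subsetsOfSize-All (suc k) []         = []
    subsetsOfSize-All (suc k) (px ∷ pxs) =
      All.++⁺ (All.map⁺ (All.map (px ∷_) (subsetsOfSize-All k pxs))) (subsetsOfSize-All (suc k) pxs)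

  -- Counting non-attacking placements by deletion.

  Compatible : Square → Square → Set
  Compatible s t = ¬ CommonDiagonal s t

  -- Abstract so that case splits on it are not defeated by unfolding.
  abstract
    compatible? : ∀ s → Decidable (Compatible s)
    compatible? s t = ¬? (commonDiagonal? s t)

  compatible-sym : ∀ s t → Compatible s t → Compatible t s
  compatible-sym s t c (inj₁ eq) = c (inj₁ (sym eq))
  compatible-sym s t c (inj₂ eq) = c (inj₂ (sym eq))

  -- The first square is either used, and then deletes the squares it attacks, or not used.
  N : ℕ → List Square → ℕ
  N zero    xs       = 1
  N (suc k) []       = 0
  N (suc k) (x ∷ xs) = N k (filter (compatible? x) xs) + N (suc k) xs

  -- As x does not recur in xs, the clause `s ≢ t` of `NonAttacking` holds between x and the rest,
  -- so the placements using x come from the squares of xs compatible with x.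
  placements≡N : ∀ k {xs} → Unique xs → placements xs k ≡ N k xs
  placements≡N zero    uniq = refl
  placements≡N (suc k) [] = refl
  placements≡N (suc k) {x ∷ xs} (x∉xs ∷ uniq) = begin
    length (filter nonAttacking? (map (x ∷_) S ++ subsetsOfSize (suc k) xs))
      ≡⟨ cong length (filter-++ nonAttacking? (map (x ∷_) S) _) ⟩
    length (filter nonAttacking? (map (x ∷_) S) ++ filter nonAttacking? (subsetsOfSize (suc k) xs))
      ≡⟨ length-++ (filter nonAttacking? (map (x ∷_) S)) ⟩
    length (filter nonAttacking? (map (x ∷_) S)) + placements xs (suc k)
      ≡⟨ cong₂ _+_ first (placements≡N (suc k) uniq) ⟩
    N k (filter (compatible? x) xs) + N (suc k) xs ∎
    where
    S = subsetsOfSize k xs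
    to : ∀ {T} → All (x ≢_) T → NonAttacking (x ∷ T) → All (Compatible x) T × NonAttacking T
    to x∉T ((_ ∷ row) ∷ rows) = All.zipWith (λ (x≢t , f) → f x≢t) (x∉T , row) , All.map All.tail rows
    from : ∀ {T} → All (Compatible x) T → NonAttacking T → NonAttacking (x ∷ T)
    from compat rows = ((λ x≢x → contradiction refl x≢x) ∷ All.map (λ c _ → c) compat)
      ∷ All.zipWith (λ {t} (c , row) → (λ _ → compatible-sym x t c) ∷ row) (compat , rows)
    first : length (filter nonAttacking? (map (x ∷_) S)) ≡ N k (filter (compatible? x) xs)
    first = begin
      length (filter nonAttacking? (map (x ∷_) S))
        ≡⟨ cong length (filter-∷-map nonAttacking? x S) ⟩
      length (map (x ∷_) (filter (nonAttacking? ∘ (x ∷_)) S))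
        ≡⟨ length-map (x ∷_) (filter (nonAttacking? ∘ (x ∷_)) S) ⟩
      length (filter (nonAttacking? ∘ (x ∷_)) S)
        ≡⟨ cong length (filter-× (nonAttacking? ∘ (x ∷_)) (all? (compatible? x)) nonAttacking?
             (All.map (λ x∉T → to x∉T , from) (subsetsOfSize-All k x∉xs))) ⟩
      length (filter nonAttacking? (filter (all? (compatible? x)) S))
        ≡⟨ cong (length ∘ filter nonAttacking?) (subsetsOfSize-filter (compatible? x) k xs) ⟨
      placements (filter (compatible? x) xs) k
        ≡⟨ placements≡N k (Unique.filter⁺ (compatible? x) uniq) ⟩
      N k (filter (compatible? x) xs) ∎

  -- If x and y attack each other, either order counts the placements with x only, with y only and
  -- with neither. If they do not, those with both come in addition, and they agree because the two
  -- deletions commute.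
  N-swap : ∀ k x y xs → N (suc k) (x ∷ y ∷ xs) ≡ N (suc k) (y ∷ x ∷ xs)
  N-swap k x y xs with compatible? x y | compatible? y x
  ... | no _   | no _   = exchange (N k (filter (compatible? x) xs)) (N k (filter (compatible? y) xs)) (N (suc k) xs)
    where
    exchange : ∀ a b c → a + (b + c) ≡ b + (a + c)
    exchange = solve-∀
  ... | yes xy | no ¬yx = contradiction (compatible-sym x y xy) ¬yx
  ... | no ¬xy | yes yx = contradiction (compatible-sym y x yx) ¬xy
  N-swap zero    x y xs | yes _ | yes _ = refl
  N-swap (suc k) x y xs | yes _ | yes _ = trans
    (cong (λ T → N k T + N (suc k) (filter (compatible? x) xs) + (N (suc k) (filter (compatible? y) xs) + N (suc (suc k)) xs))
          (filter-comm (compatible? y) (compatible? x) xs))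
    (exchange (N k (filter (compatible? x) (filter (compatible? y) xs))) (N (suc k) (filter (compatible? x) xs))
      (N (suc k) (filter (compatible? y) xs)) (N (suc (suc k)) xs))
    where
    exchange : ∀ p a b c → p + a + (b + c) ≡ p + b + (a + c)
    exchange = solve-∀

  -- `N` follows the order of its list, while the boards have to be rearranged: each colour by
  -- diagonals, the whole board by colour.
  N-↭ : ∀ k {xs ys} → xs ↭ ys → N k xs ≡ N k ys
  N-↭ zero    _            = refl
  N-↭ (suc k) ↭-refl       = refl
  N-↭ (suc k) (p ⟫ q)      = trans (N-↭ (suc k) p) (N-↭ (suc k) q)
  N-↭ (suc k) (prep x p)   = cong₂ _+_ (N-↭ k (filter-↭ (compatible? x) p)) (N-↭ (suc k) p)
  N-↭ (suc k) (swap {xs} x y p) = trans (N-swap k x y xs)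
    (cong₂ _+_ (N-↭ k (filter-↭ (compatible? y) (prep x p)))
               (cong₂ _+_ (N-↭ k (filter-↭ (compatible? x) p)) (N-↭ (suc k) p)))

  -- The generating function for x ∷ xs is that for xs plus t times that for the squares of xs
  -- compatible with x. The squares of ys survive each of these deletions, so the whole recurrence
  -- is multiplied by the series of ys.
  N-++ : ∀ k xs {ys} → All (λ x → All (Compatible x) ys) xs →
         + N k (xs ++ ys) ≡ ((λ j → + N j xs) ⋆ (λ j → + N j ys)) k
  N-++ zero    xs compat = refl
  N-++ (suc k) [] {ys} [] = sym (trans (sumTo-cong (suc k) (λ i → cong (ℤ._* + N (suc k ∸ i) ys) (N-[] i)))
                                       (⋆-identityˡ (λ j → + N j ys) (suc k)))
    where
    N-[] : ∀ i → + N i [] ≡ δ i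
    N-[] zero    = refl
    N-[] (suc i) = refl
  N-++ (suc k) (x ∷ xs) {ys} (cx ∷ cxs) = begin
    + N k (filter (compatible? x) (xs ++ ys)) ℤ.+ + N (suc k) (xs ++ ys)
      ≡⟨ cong (λ T → + N k T ℤ.+ + N (suc k) (xs ++ ys))
           (trans (filter-++ (compatible? x) xs ys) (cong (filter (compatible? x) xs ++_) (filter-all (compatible? x) cx))) ⟩
    + N k (filter (compatible? x) xs ++ ys) ℤ.+ + N (suc k) (xs ++ ys)
      ≡⟨ cong₂ ℤ._+_ (N-++ k (filter (compatible? x) xs) (All.filter⁺ (compatible? x) cxs)) (N-++ (suc k) xs cxs) ⟩
    (h ⋆ g) k ℤ.+ (f′ ⋆ g) (suc k)
      ≡⟨ ℤ.+-comm ((h ⋆ g) k) _ ⟩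
    (f′ ⋆ g) (suc k) ℤ.+ (h ⋆ g) k
      ≡⟨ cong (λ t → (f′ ⋆ g) (suc k) ℤ.+ t) (ℤ.*-identityˡ ((h ⋆ g) k)) ⟨
    (f′ ⋆ g) (suc k) ℤ.+ 1ℤ ℤ.* (h ⋆ g) k
      ≡⟨ ⋆-stepˡ 1ℤ f f′ h g refl (λ n → trans (ℤ.+-comm (h n) (f′ (suc n)))
           (cong (λ t → f′ (suc n) ℤ.+ t) (sym (ℤ.*-identityˡ (h n))))) k ⟨
    (f ⋆ g) (suc k) ∎
    where
    f f′ g h : ℕ → ℤ
    f j = + N j (x ∷ xs)
    f′ j = + N j xs
    g j = + N j ys
    h j = + N j (filter (compatible? x) xs)

  -- Adding one diagonal: the rook recurrence.

  diff : Square → ℤ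
  diff (i , j) = i ⊖ j

  attackers : Square → List Square → List Square
  attackers t = filter (λ x → ¬? (compatible? x t))

  -- Counts the placements with one bishop on the row and k bishops on L.
  rowSum : ℕ → List Square → List Square → ℕ
  rowSum k row L = sum (map (λ x → N k (filter (compatible? x) L)) row)

  -- In rook terms, t lies in another row and its column meets the given row in one cell. The
  -- nestedness of the Ferrers board enters the count only through this.
  record Crosses (row : List Square) (t : Square) : Set where
    constructor crosses
    field
      off  : All (λ x → diff x ≢ diff t) row
      once : length (attackers t row) ≡ 1

  -- For x compatible with t, the count on the squares left by x splits according to the use of t.
  -- For x attacking t, no placement uses both; but x and t share an antidiagonal, so x deletes
  -- nothing from the squares compatible with t, and the term N k that is missing is the one that
  -- each attacker adds on the left.
  rowSum-∷ : ∀ k {row} t L → (∀ x → x ∈ row → All (λ t′ → diff x ≢ diff t′) (t ∷ L)) →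
    rowSum (suc k) row (t ∷ L) + length (attackers t row) * N k (filter (compatible? t) L)
    ≡ rowSum (suc k) row L + rowSum k row (filter (compatible? t) L)
  rowSum-∷ k {[]}      t L off = refl
  rowSum-∷ k {x ∷ row} t L off with compatible? x t
  ... | yes _ = trans
    (cong (λ T → N k T + N (suc k) (filter (compatible? x) L) + rowSum (suc k) row (t ∷ L)
                 + length (attackers t row) * N k (filter (compatible? t) L))
          (filter-comm (compatible? t) (compatible? x) L))
    (trans (shuffle (N k (filter (compatible? x) (filter (compatible? t) L))) (N (suc k) (filter (compatible? x) L)) _ _)
    (trans (cong (λ s → N k (filter (compatible? x) (filter (compatible? t) L)) + N (suc k) (filter (compatible? x) L) + s)
             (rowSum-∷ k t L (λ y y∈ → off y (there y∈))))
           (shuffle′ (N k (filter (compatible? x) (filter (compatible? t) L))) (N (suc k) (filter (compatible? x) L)) _ _)))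
    where
    shuffle : ∀ a b c d → a + b + c + d ≡ a + b + (c + d)
    shuffle = solve-∀
    shuffle′ : ∀ a b c d → a + b + (c + d) ≡ b + c + (a + d)
    shuffle′ = solve-∀
  ... | no ¬xt = begin
    N (suc k) (filter (compatible? x) L) + rowSum (suc k) row (t ∷ L) + (N k L′ + length (attackers t row) * N k L′)
      ≡⟨ shuffle (N (suc k) (filter (compatible? x) L)) _ (N k L′) _ ⟩
    N (suc k) (filter (compatible? x) L) + N k L′ + (rowSum (suc k) row (t ∷ L) + length (attackers t row) * N k L′)
      ≡⟨ cong (λ s → N (suc k) (filter (compatible? x) L) + N k L′ + s) (rowSum-∷ k t L (λ y y∈ → off y (there y∈))) ⟩
    N (suc k) (filter (compatible? x) L) + N k L′ + (rowSum (suc k) row L + rowSum k row L′)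
      ≡⟨ shuffle (N (suc k) (filter (compatible? x) L)) (N k L′) (rowSum (suc k) row L) _ ⟩
    N (suc k) (filter (compatible? x) L) + rowSum (suc k) row L + (N k L′ + rowSum k row L′)
      ≡⟨ cong (λ T → N (suc k) (filter (compatible? x) L) + rowSum (suc k) row L + (N k T + rowSum k row L′))
           (filter-all (compatible? x) (All.zipWith (λ {t′} (o , c) → sameAntidiagonal t′ o c)
             (All.filter⁺ (compatible? t) (All.tail (off x (here refl))) , All.all-filter (compatible? t) L))) ⟨
    N (suc k) (filter (compatible? x) L) + rowSum (suc k) row L + (N k (filter (compatible? x) L′) + rowSum k row L′) ∎
    where
    L′ = filter (compatible? t) L
    shuffle : ∀ a b c d → a + b + (c + d) ≡ a + c + (b + d)
    shuffle = solve-∀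
    sameAntidiagonal : ∀ t′ → diff x ≢ diff t′ → Compatible t t′ → Compatible x t′
    sameAntidiagonal t′ o c (inj₁ xt′) = o xt′
    sameAntidiagonal t′ o c (inj₂ xt′) = ¬xt λ where
      (inj₁ xt₁) → All.head (off x (here refl)) xt₁
      (inj₂ xt₂) → c (inj₂ (trans (sym xt₂) xt′))

  -- A placement of k bishops on L attacks exactly k squares of the row.
  rowSum-crosses : ∀ k row L → All (Crosses row) L → rowSum k row L + k * N k L ≡ length row * N k L
  rowSum-crosses zero    row L cross = trans (+-identityʳ _) (ones row)
    where
    ones : ∀ row → rowSum zero row L ≡ length row * 1
    ones []        = refl
    ones (x ∷ row) = cong suc (ones row)
  rowSum-crosses (suc k) row []      cross = trans (cong (λ s → rowSum (suc k) row [] + s) (*-zeroʳ k)) (trans (+-identityʳ _) (zeros row))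
    where
    zeros : ∀ row → rowSum (suc k) row [] ≡ length row * 0
    zeros []        = refl
    zeros (x ∷ row) = zeros row
  rowSum-crosses (suc k) row (t ∷ L) cross@(crosses _ once ∷ cross′) = begin
    rowSum (suc k) row (t ∷ L) + suc k * (b + a)
      ≡⟨ regroup (rowSum (suc k) row (t ∷ L)) k b a ⟩
    (rowSum (suc k) row (t ∷ L) + 1 * b) + k * b + suc k * a
      ≡⟨ cong (λ n → rowSum (suc k) row (t ∷ L) + n * b + k * b + suc k * a) once ⟨
    (rowSum (suc k) row (t ∷ L) + length (attackers t row) * b) + k * b + suc k * a
      ≡⟨ cong (λ n → n + k * b + suc k * a)
           (rowSum-∷ k t L (λ x x∈row → All.map (λ c → All.lookup (Crosses.off c) x∈row) cross)) ⟩
    rowSum (suc k) row L + rowSum k row L′ + k * b + suc k * a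
      ≡⟨ regroup′ (rowSum (suc k) row L) (rowSum k row L′) (k * b) (suc k * a) ⟩
    (rowSum k row L′ + k * b) + (rowSum (suc k) row L + suc k * a)
      ≡⟨ cong₂ _+_ (rowSum-crosses k row L′ (All.filter⁺ (compatible? t) cross′)) (rowSum-crosses (suc k) row L cross′) ⟩
    length row * b + length row * a
      ≡⟨ *-distribˡ-+ (length row) b a ⟨
    length row * (b + a) ∎
    where
    L′ = filter (compatible? t) L
    a = N (suc k) L
    b = N k L′
    regroup : ∀ r k b a → r + suc k * (b + a) ≡ r + 1 * b + k * b + suc k * a
    regroup = solve-∀
    regroup′ : ∀ r s x y → r + s + x + y ≡ (s + x) + (r + y)
    regroup′ = solve-∀

  -- The row lies on one diagonal, so a bishop on it deletes all its other squares.
  N-row-++ : ∀ k {d} row L → All (λ x → diff x ≡ d) row → N (suc k) (row ++ L) ≡ rowSum k row L + N (suc k) L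
  N-row-++ k []        L _ = refl
  N-row-++ k (x ∷ row) L (dx ∷ drow) = begin
    N k (filter (compatible? x) (row ++ L)) + N (suc k) (row ++ L)
      ≡⟨ cong₂ (λ T n → N k T + n)
           (trans (filter-++ (compatible? x) row L) (cong (_++ filter (compatible? x) L)
             (filter-none (compatible? x) (All.map (λ dy c → c (inj₁ (trans dx (sym dy)))) drow))))
           (N-row-++ k row L drow) ⟩
    N k (filter (compatible? x) L) + (rowSum k row L + N (suc k) L)
      ≡⟨ +-assoc (N k (filter (compatible? x) L)) _ _ ⟨
    rowSum k (x ∷ row) L + N (suc k) L ∎

  -- By `rowSum-crosses`, k bishops on L leave all but k squares of the row free. The difference is
  -- formed in ℤ because k may exceed the length of the row.
  N-addRow : ∀ k {d} row L → All (λ x → diff x ≡ d) row → All (Crosses row) L →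
    + N (suc k) (row ++ L) ≡ + N (suc k) L ℤ.+ (+ length row ℤ.- + k) ℤ.* + N k L
  N-addRow k row L same cross = begin
    + N (suc k) (row ++ L)
      ≡⟨ cong +_ (N-row-++ k row L same) ⟩
    + rowSum k row L ℤ.+ + N (suc k) L
      ≡⟨ rearrange (+ rowSum k row L) (+ N (suc k) L) (+ k ℤ.* + N k L) ⟩
    + N (suc k) L ℤ.+ (+ rowSum k row L ℤ.+ + k ℤ.* + N k L ℤ.- + k ℤ.* + N k L)
      ≡⟨ cong (λ t → + N (suc k) L ℤ.+ (t ℤ.- + k ℤ.* + N k L)) (begin
           + rowSum k row L ℤ.+ + k ℤ.* + N k L   ≡⟨ cong (λ t → + rowSum k row L ℤ.+ t) (ℤ.pos-* k (N k L)) ⟨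
           + (rowSum k row L + k * N k L)         ≡⟨ cong +_ (rowSum-crosses k row L cross) ⟩
           + (length row * N k L)                 ≡⟨ ℤ.pos-* (length row) (N k L) ⟩
           + length row ℤ.* + N k L               ∎) ⟩
    + N (suc k) L ℤ.+ (+ length row ℤ.* + N k L ℤ.- + k ℤ.* + N k L)
      ≡⟨ factor (+ N (suc k) L) (+ length row) (+ k) (+ N k L) ⟩
    + N (suc k) L ℤ.+ (+ length row ℤ.- + k) ℤ.* + N k L ∎
    where
    rearrange : ∀ r n x → r ℤ.+ n ≡ n ℤ.+ (r ℤ.+ x ℤ.- x)
    rearrange = ℤ.solve-∀
    factor : ∀ n l k x → n ℤ.+ (l ℤ.* x ℤ.- k ℤ.* x) ≡ n ℤ.+ (l ℤ.- k) ℤ.* x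
    factor = ℤ.solve-∀

  -- The diagonals of one colour as a Ferrers board.

  lower upper : ℕ → ℕ → List Square
  lower c ℓ = applyUpTo (λ t → c + suc t , suc t) ℓ
  upper c ℓ = applyUpTo (λ t → suc t , c + suc t) ℓ

  -- With n + c = m, the diagonals of one colour of the m × m board that have length at most n,
  -- in order of decreasing length; the flag says whether the longest one has length n.
  diagonals : Bool → ℕ → ℕ → List Square
  diagonals _     c zero    = []
  diagonals true  c (suc n) = lower c (suc n) ++ diagonals false (suc c) n
  diagonals false c (suc n) = upper (suc c) n ++ diagonals true (suc c) n

  ⊖-≡⇒ : ∀ a b c d → a ⊖ b ≡ c ⊖ d → a + d ≡ c + b
  ⊖-≡⇒ a b c d eq = ℤ.+-injective (begin
    + a ℤ.+ + d                                 ≡⟨ left (+ a) (+ b) (+ d) ⟩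
    (+ a ℤ.- + b) ℤ.+ (+ b ℤ.+ + d)
      ≡⟨ cong (λ t → t ℤ.+ (+ b ℤ.+ + d)) (trans (ℤ.[+m]-[+n]≡m⊖n a b) (trans eq (sym (ℤ.[+m]-[+n]≡m⊖n c d)))) ⟩
    (+ c ℤ.- + d) ℤ.+ (+ b ℤ.+ + d)             ≡⟨ right (+ c) (+ d) (+ b) ⟩
    + c ℤ.+ + b                                 ∎)
    where
    left : ∀ a b d → a ℤ.+ d ≡ (a ℤ.- b) ℤ.+ (b ℤ.+ d)
    left = ℤ.solve-∀
    right : ∀ c d b → (c ℤ.- d) ℤ.+ (b ℤ.+ d) ≡ c ℤ.+ b
    right = ℤ.solve-∀

  -- An invariant of `diagonals`. The first half says that the antidiagonal of every listed square
  -- meets the first row of the list, which is the nestedness of the Ferrers board. The second half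
  -- separates the square from the longer diagonals taken before.
  Shape : Bool → ℕ → ℕ → Square → Set
  Shape true  c n (i , j) = (∃ λ s → s < n × i + j ≡ c + (suc s + suc s)) × (j + c ≤ i ⊎ i + suc c ≤ j)
  Shape false c n (i , j) = (∃ λ s → suc s < n × i + j ≡ suc c + (suc s + suc s)) × (j + suc c ≤ i ⊎ i + suc c ≤ j)

  shape : ∀ e c n {s} → s ∈ diagonals e c n → Shape e c n s
  shape true c (suc n) s∈ with ∈-++⁻ (lower c (suc n)) s∈
  ... | inj₁ s∈row with t , t<n , refl ← ∈-applyUpTo⁻ (λ t → c + suc t , suc t) s∈row =
    (t , t<n , +-assoc c (suc t) (suc t)) , inj₁ (≤-reflexive (+-comm (suc t) c))
  ... | inj₂ s∈rest with shape false (suc c) n s∈rest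
  ... | (s , s<n , eq) , far = (suc s , m<n⇒m<1+n s<n , trans eq (move c s)) , relax far
    where
    move : ∀ c s → suc (suc c) + (suc s + suc s) ≡ c + (suc (suc s) + suc (suc s))
    move = solve-∀
    relax : ∀ {i j} → j + suc (suc c) ≤ i ⊎ i + suc (suc c) ≤ j → j + c ≤ i ⊎ i + suc c ≤ j
    relax {i} {j} (inj₁ le) = inj₁ (≤-trans (+-monoʳ-≤ j (≤-trans (n≤1+n c) (n≤1+n (suc c)))) le)
    relax {i} {j} (inj₂ le) = inj₂ (≤-trans (+-monoʳ-≤ i (n≤1+n (suc c))) le)
  shape false c (suc n) s∈ with ∈-++⁻ (upper (suc c) n) s∈
  ... | inj₁ s∈row with t , t<n , refl ← ∈-applyUpTo⁻ (λ t → suc t , suc c + suc t) s∈row =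
    (t , s≤s t<n , move c t) , inj₂ (≤-reflexive (+-comm (suc t) (suc c)))
    where
    move : ∀ c t → suc t + (suc c + suc t) ≡ suc c + (suc t + suc t)
    move = solve-∀
  ... | inj₂ s∈rest with shape true (suc c) n s∈rest
  ... | (s , s<n , eq) , far = (s , s≤s s<n , eq) , relax far
    where
    relax : ∀ {i j} → j + suc c ≤ i ⊎ i + suc (suc c) ≤ j → j + suc c ≤ i ⊎ i + suc c ≤ j
    relax {i} {j} (inj₁ le) = inj₁ le
    relax {i} {j} (inj₂ le) = inj₂ (≤-trans (+-monoʳ-≤ i (n≤1+n (suc c))) le)

  length-filter-applyUpTo : ∀ {A : Set} {P : Pred A 0ℓ} (P? : Decidable P) f {n s} → s < n → P (f s) →
                            (∀ t → P (f t) → t ≡ s) → length (filter P? (applyUpTo f n)) ≡ 1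
  length-filter-applyUpTo P? f {suc n} {zero} s<n Pfs only =
    trans (cong length (filter-accept P? Pfs))
          (cong (suc ∘ length) (filter-none P? (All.applyUpTo⁺₂ (f ∘ suc) n λ t p → 1+n≢0 (only (suc t) p))))
  length-filter-applyUpTo P? f {suc n} {suc s} (s≤s s<n) Pfs only =
    trans (cong length (filter-reject P? (λ p → 0≢1+n (only 0 p))))
          (length-filter-applyUpTo P? (f ∘ suc) s<n Pfs (λ t p → suc-injective (only (suc t) p)))

  -- The square f i has coordinate sum c + 2 (i + 1) and t has c + 2 (s + 1), so t attacks f s and
  -- no other square of the row.
  crosses-applyUpTo : ∀ f {n} c s t → (∀ i → proj₁ (f i) + proj₂ (f i) ≡ c + (suc i + suc i)) →
                      (∀ i → diff (f i) ≢ diff t) → s < n → proj₁ t + proj₂ t ≡ c + (suc s + suc s) →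
                      Crosses (applyUpTo f n) t
  crosses-applyUpTo f {n} c s t sum-f off s<n sum-t = crosses (All.applyUpTo⁺₂ f n off)
    (length-filter-applyUpTo (λ x → ¬? (compatible? x t)) f s<n
      (λ c → c (inj₂ (trans (sum-f s) (sym sum-t))))
      only)
    where
    double-injective : ∀ a b → suc a + suc a ≡ suc b + suc b → a ≡ b
    double-injective a b eq = suc-injective (*-cancelˡ-≡ (suc a) (suc b) 2 (trans (twice (suc a)) (trans eq (sym (twice (suc b))))))
      where
      twice : ∀ a → 2 * a ≡ a + a
      twice = solve-∀
    only : ∀ i → ¬ Compatible (f i) t → i ≡ s
    only i ¬¬cd with commonDiagonal? (f i) t
    ... | yes (inj₁ eq) = contradiction eq (off i)
    ... | yes (inj₂ eq) = double-injective i s (+-cancelˡ-≡ c _ _ (trans (sym (sum-f i)) (trans eq sum-t)))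
    ... | no ¬cd = contradiction ¬cd ¬¬cd

  lower-crosses : ∀ c n {t} → t ∈ diagonals false (suc c) n → Crosses (lower c (suc n)) t
  lower-crosses c n {i , j} t∈ with shape false (suc c) n t∈
  -- The index on the row is s + 1: coordinate sums start at c + 2 on the row and at c + 4 on the
  -- rest.
  ... | (s , s<n , eq) , far = crosses-applyUpTo (λ t → c + suc t , suc t) c (suc s) (i , j)
    (λ t → +-assoc c (suc t) (suc t)) off (m<n⇒m<1+n s<n) (trans eq (move c s))
    where
    move : ∀ c s → suc (suc c) + (suc s + suc s) ≡ c + (suc (suc s) + suc (suc s))
    move = solve-∀
    regroup : ∀ c t j → c + t + j ≡ j + c + t
    regroup = solve-∀
    far⇒≢ : j + suc (suc c) ≤ i ⊎ i + suc (suc c) ≤ j → j + c ≢ i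
    far⇒≢ (inj₁ le) refl = <-irrefl refl (≤-trans (n≤1+n (suc c)) (+-cancelˡ-≤ j (suc (suc c)) c le))
    far⇒≢ (inj₂ le) refl = m+1+n≰m j (≤-trans (+-monoˡ-≤ (suc (suc c)) (m≤m+n j c)) le)
    off : ∀ t → (c + suc t) ⊖ suc t ≢ i ⊖ j
    off t e = far⇒≢ far (+-cancelʳ-≡ (suc t) _ _ (trans (sym (regroup c (suc t) j)) (⊖-≡⇒ (c + suc t) (suc t) i j e)))

  upper-crosses : ∀ c n {t} → t ∈ diagonals true (suc c) n → Crosses (upper (suc c) n) t
  upper-crosses c n {i , j} t∈ with shape true (suc c) n t∈
  ... | (s , s<n , eq) , far = crosses-applyUpTo (λ t → suc t , suc c + suc t) (suc c) s (i , j) (move c) off s<n eq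
    where
    move : ∀ c t → suc t + (suc c + suc t) ≡ suc c + (suc t + suc t)
    move = solve-∀
    regroup : ∀ i c t → i + (c + t) ≡ i + c + t
    regroup = solve-∀
    far⇒≢ : j + suc c ≤ i ⊎ i + suc (suc c) ≤ j → i + suc c ≢ j
    far⇒≢ (inj₁ le) refl = m+1+n≰m i (≤-trans (+-monoˡ-≤ (suc c) (m≤m+n i (suc c))) le)
    far⇒≢ (inj₂ le) refl = <-irrefl refl (≤-trans (≤-reflexive (sym (+-suc i (suc c)))) le)
    off : ∀ t → suc t ⊖ (suc c + suc t) ≢ i ⊖ j
    off t e = far⇒≢ far (sym (+-cancelʳ-≡ (suc t) _ _ (trans (+-comm j (suc t))
      (trans (⊖-≡⇒ (suc t) (suc c + suc t) i j e) (regroup i (suc c) (suc t))))))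

  -- The rounded halves ⌈n/2⌉ for `true` and ⌊n/2⌋ for `false`. At size n + 1 the staircase row has
  -- n cells; `lower c (suc n)` has one more, `upper (suc c) n` exactly as many.
  extraCells : Bool → ℕ → ℕ
  extraCells _     zero    = 0
  extraCells true  (suc n) = suc (extraCells false n)
  extraCells false (suc n) = extraCells true n

  lower-diff : ∀ c ℓ → All (λ x → diff x ≡ c ⊖ 0) (lower c ℓ)
  lower-diff c ℓ = All.applyUpTo⁺₂ _ ℓ λ t →
    trans (cong₂ _⊖_ (+-comm c (suc t)) (sym (+-identityʳ (suc t)))) (ℤ.+-cancelˡ-⊖ (suc t) c 0)

  upper-diff : ∀ c ℓ → All (λ x → diff x ≡ 0 ⊖ c) (upper c ℓ)
  upper-diff c ℓ = All.applyUpTo⁺₂ _ ℓ λ t →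
    trans (cong₂ _⊖_ (sym (+-identityʳ (suc t))) (+-comm c (suc t))) (ℤ.+-cancelˡ-⊖ (suc t) 0 c)

  -- The longest row is removed first, so that every remaining square crosses it. A row of n + 1
  -- squares matches `F-step′`, one of n squares `F-step`.
  N-diagonals : ∀ e c n k → + N k (diagonals e c n) ≡ F (+ n) (+ extraCells e n) k
  N-diagonals e     c n       zero    = refl
  N-diagonals true  c zero    (suc k) = sym (F-0 k)
  N-diagonals false c zero    (suc k) = sym (F-0 k)
  N-diagonals true  c (suc n) (suc k) = begin
    + N (suc k) (lower c (suc n) ++ L)
      ≡⟨ N-addRow k (lower c (suc n)) L (lower-diff c (suc n)) (All.tabulate (lower-crosses c n)) ⟩
    + N (suc k) L ℤ.+ (+ length (lower c (suc n)) ℤ.- + k) ℤ.* + N k L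
      ≡⟨ cong (λ ℓ → + N (suc k) L ℤ.+ (+ ℓ ℤ.- + k) ℤ.* + N k L) (length-applyUpTo (λ t → c + suc t , suc t) (suc n)) ⟩
    + N (suc k) L ℤ.+ (+ suc n ℤ.- + k) ℤ.* + N k L
      ≡⟨ cong₂ (λ a b → a ℤ.+ (+ suc n ℤ.- + k) ℤ.* b) (N-diagonals false (suc c) n (suc k)) (N-diagonals false (suc c) n k) ⟩
    F (+ n) y (suc k) ℤ.+ (+ suc n ℤ.- + k) ℤ.* F (+ n) y k
      ≡⟨ F-step′ (+ n) y k ⟨
    F (+ suc n) (+ suc (extraCells false n)) (suc k) ∎
    where
    L = diagonals false (suc c) n
    y = + extraCells false n
  N-diagonals false c (suc n) (suc k) = begin
    + N (suc k) (upper (suc c) n ++ L)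
      ≡⟨ N-addRow k (upper (suc c) n) L (upper-diff (suc c) n) (All.tabulate (upper-crosses c n)) ⟩
    + N (suc k) L ℤ.+ (+ length (upper (suc c) n) ℤ.- + k) ℤ.* + N k L
      ≡⟨ cong (λ ℓ → + N (suc k) L ℤ.+ (+ ℓ ℤ.- + k) ℤ.* + N k L) (length-applyUpTo (λ t → suc t , suc c + suc t) n) ⟩
    + N (suc k) L ℤ.+ (+ n ℤ.- + k) ℤ.* + N k L
      ≡⟨ cong₂ (λ a b → a ℤ.+ (+ n ℤ.- + k) ℤ.* b) (N-diagonals true (suc c) n (suc k)) (N-diagonals true (suc c) n k) ⟩
    F (+ n) y (suc k) ℤ.+ (+ n ℤ.- + k) ℤ.* F (+ n) y k
      ≡⟨ F-step (+ n) y k ⟨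
    F (+ suc n) y (suc k) ∎
    where
    L = diagonals true (suc c) n
    y = + extraCells true n

  diagonals-unique : ∀ e c n → Unique (diagonals e c n)
  diagonals-unique true  c zero    = []
  diagonals-unique false c zero    = []
  diagonals-unique true  c (suc n) = Unique.++⁺
    (Unique.applyUpTo⁺₁ (λ t → c + suc t , suc t) (suc n) (λ i<j _ eq → <⇒≢ i<j (suc-injective (cong proj₂ eq))))
    (diagonals-unique false (suc c) n)
    -- By `off`, a common square would lie on a diagonal different from its own.
    (λ (x∈row , x∈L) → All.lookup (Crosses.off (lower-crosses c n x∈L)) x∈row refl)
  diagonals-unique false c (suc n) = Unique.++⁺
    (Unique.applyUpTo⁺₁ (λ t → suc t , suc c + suc t) n (λ i<j _ eq → <⇒≢ i<j (suc-injective (cong proj₁ eq))))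
    (diagonals-unique true (suc c) n)
    (λ (x∈row , x∈L) → All.lookup (Crosses.off (upper-crosses c n x∈L)) x∈row refl)

  -- The two colour classes as lists of diagonals.

  InRange : ℕ → ℕ → Set
  InRange m i = 1 ≤ i × i ≤ m

  Bounded : ℕ → Square → Set
  Bounded m (i , j) = InRange m i × InRange m j

  diagonals-bounded : ∀ e c n {s} → s ∈ diagonals e c n → Bounded (n + c) s
  diagonals-bounded true c (suc n) {s} s∈ with ∈-++⁻ (lower c (suc n)) s∈
  ... | inj₁ s∈row with t , t<n , refl ← ∈-applyUpTo⁻ (λ t → c + suc t , suc t) s∈row =
    (≤-trans (s≤s z≤n) (m≤n+m (suc t) c) , ≤-trans (+-monoʳ-≤ c t<n) (≤-reflexive (+-comm c (suc n)))) ,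
    (s≤s z≤n , ≤-trans t<n (m≤m+n (suc n) c))
  ... | inj₂ s∈rest = subst (λ m → Bounded m s) (+-suc n c) (diagonals-bounded false (suc c) n s∈rest)
  diagonals-bounded false c (suc n) {s} s∈ with ∈-++⁻ (upper (suc c) n) s∈
  ... | inj₁ s∈row with t , t<n , refl ← ∈-applyUpTo⁻ (λ t → suc t , suc c + suc t) s∈row =
    (s≤s z≤n , ≤-trans t<n (≤-trans (n≤1+n n) (m≤m+n (suc n) c))) ,
    (s≤s z≤n , s≤s (≤-trans (+-monoʳ-≤ c t<n) (≤-reflexive (+-comm c n))))
  ... | inj₂ s∈rest = subst (λ m → Bounded m s) (+-suc n c) (diagonals-bounded true (suc c) n s∈rest)

  odd≢even : ∀ a b → suc (a + a) ≢ b + b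
  odd≢even zero    (suc b) eq = 0≢1+n (trans (suc-injective eq) (+-suc b b))
  odd≢even (suc a) (suc b) eq = odd≢even b (suc a) (sym (trans (suc-injective eq) (+-suc b b)))

  -- The search starts at the longest diagonal and moves to shorter ones. Either the lower bound on
  -- the distance from the main diagonal is attained on the side of the current row, and the square
  -- lies on that row, or the bound can be raised; where this passes a diagonal of the other colour,
  -- the parity of i + j excludes it.
  ∈-diagonals-true : ∀ c n i j r → InRange (n + c) i → InRange (n + c) j →
    j + c ≤ i ⊎ i + suc c ≤ j → i + j ≡ c + (r + r) → (i , j) ∈ diagonals true c n
  ∈-diagonals-false : ∀ c n i j r → InRange (n + c) i → InRange (n + c) j →
    j + suc c ≤ i ⊎ i + suc c ≤ j → i + j ≡ suc c + (r + r) → (i , j) ∈ diagonals false c n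

  ∈-diagonals-true c zero i j r (_ , i≤c) (1≤j , _) (inj₁ le) eq =
    contradiction (≤-trans (+-monoˡ-≤ c 1≤j) (≤-trans le i≤c)) 1+n≰n
  ∈-diagonals-true c zero i j r _ (_ , j≤c) (inj₂ le) eq =
    contradiction (≤-trans (m≤n+m (suc c) i) (≤-trans le j≤c)) 1+n≰n
  ∈-diagonals-true c (suc n) i j r ri rj far eq = case far of λ where
      (inj₁ le) → case m≤n⇒m<n∨m≡n le of λ where
        (inj₂ j+c≡i) → ∈-++⁺ˡ (onRow rj j+c≡i)
        (inj₁ lt) → case m≤n⇒m<n∨m≡n lt of λ where
          (inj₁ lt′) → next r eq (inj₁ (≤-trans (≤-reflexive (shift₂ j c)) lt′))
          -- Here i = j + c + 1, a diagonal of the other colour.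
          (inj₂ refl) → contradiction (+-cancelˡ-≡ c _ _ (trans (regroup c j) eq)) (odd≢even j r)
      (inj₂ le) → case m≤n⇒m<n∨m≡n le of λ where
        (inj₁ lt) → next r eq (inj₂ (≤-trans (≤-reflexive (+-suc i (suc c))) lt))
        (inj₂ refl) → contradiction (+-cancelˡ-≡ c _ _ (trans (regroup′ c i) eq)) (odd≢even i r)
    where
    shift₂ : ∀ j c → j + suc (suc c) ≡ suc (suc (j + c))
    shift₂ = solve-∀
    regroup : ∀ c j → c + suc (j + j) ≡ suc (j + c) + j
    regroup = solve-∀
    regroup′ : ∀ c i → c + suc (i + i) ≡ i + (i + suc c)
    regroup′ = solve-∀
    shift-r : ∀ c r → c + (suc r + suc r) ≡ suc (suc c) + (r + r)
    shift-r = solve-∀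
    onRow : ∀ {j} → InRange (suc n + c) j → j + c ≡ i → (i , j) ∈ lower c (suc n)
    onRow {suc j} _ refl = subst (λ t → (t , suc j) ∈ lower c (suc n)) (+-comm c (suc j))
      (∈-applyUpTo⁺ (λ t → c + suc t , suc t) (+-cancelʳ-≤ c (suc j) (suc n) (proj₂ ri)))
    next : ∀ r → i + j ≡ c + (r + r) → j + suc (suc c) ≤ i ⊎ i + suc (suc c) ≤ j → (i , j) ∈ diagonals true c (suc n)
    -- For r = 0 the sum i + j is c, while `far` makes it at least c + 2.
    next zero eq far = contradiction (case far of λ where
        (inj₁ le) → ≤-trans (m≤n+m (suc (suc c)) j) (≤-trans le (m≤m+n i j))
        (inj₂ le) → ≤-trans (m≤n+m (suc (suc c)) i) (≤-trans le (m≤n+m j i)))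
      (λ le → 1+n≰n (≤-trans (n≤1+n (suc c)) (≤-trans le (≤-reflexive (trans eq (+-identityʳ c))))))
    next (suc r) eq far = ∈-++⁺ʳ (lower c (suc n))
      (∈-diagonals-false (suc c) n i j r (subst (λ m → InRange m i) (sym (+-suc n c)) ri)
        (subst (λ m → InRange m j) (sym (+-suc n c)) rj) far (trans eq (shift-r c r)))

  ∈-diagonals-false c zero i j r (_ , i≤c) _ (inj₁ le) eq =
    contradiction (≤-trans (m≤n+m (suc c) j) (≤-trans le i≤c)) 1+n≰n
  ∈-diagonals-false c zero i j r _ (_ , j≤c) (inj₂ le) eq =
    contradiction (≤-trans (m≤n+m (suc c) i) (≤-trans le j≤c)) 1+n≰n
  ∈-diagonals-false c (suc n) i j r ri rj far eq = case far of λ where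
      (inj₁ le) → next (inj₁ le)
      (inj₂ le) → case m≤n⇒m<n∨m≡n le of λ where
        (inj₁ lt) → next (inj₂ (≤-trans (≤-reflexive (+-suc i (suc c))) lt))
        (inj₂ i+c≡j) → ∈-++⁺ˡ (onRow ri i+c≡j)
    where
    onRow : ∀ {i} → InRange (suc n + c) i → i + suc c ≡ j → (i , j) ∈ upper (suc c) n
    onRow {suc i} _ refl = subst (λ t → (suc i , t) ∈ upper (suc c) n) (+-comm (suc c) (suc i))
      (∈-applyUpTo⁺ (λ t → suc t , suc c + suc t)
        (+-cancelʳ-≤ (suc c) (suc i) n (≤-trans (proj₂ rj) (≤-reflexive (sym (+-suc n c))))))
    next : j + suc c ≤ i ⊎ i + suc (suc c) ≤ j → (i , j) ∈ diagonals false c (suc n)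
    next far = ∈-++⁺ʳ (upper (suc c) n)
      (∈-diagonals-true (suc c) n i j r (subst (λ m → InRange m i) (sym (+-suc n c)) ri)
        (subst (λ m → InRange m j) (sym (+-suc n c)) rj) far eq)

  ∈-range⁺ : ∀ {m i} → InRange m i → i ∈ range 1 m
  ∈-range⁺ {m} {suc i} (_ , i<m) = ∈-applyUpTo⁺ suc i<m

  ∈-range⁻ : ∀ {m i} → i ∈ range 1 m → InRange m i
  ∈-range⁻ i∈ with t , t<m , refl ← ∈-applyUpTo⁻ suc i∈ = s≤s z≤n , t<m

  board-unique : ∀ m → Unique (board m)
  board-unique m = Unique.cartesianProduct⁺ range-unique range-unique
    where
    range-unique : Unique (range 1 m)
    range-unique = Unique.applyUpTo⁺₁ suc m λ i<j _ eq → <⇒≢ i<j (suc-injective eq)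

  parity : ∀ n → (∃ λ r → n ≡ r + r) ⊎ (∃ λ r → n ≡ suc (r + r))
  parity zero    = inj₁ (0 , refl)
  parity (suc n) with parity n
  ... | inj₁ (r , refl) = inj₂ (r , refl)
  ... | inj₂ (r , refl) = inj₁ (suc r , cong suc (sym (+-suc r r)))

  double : ∀ r → r * 2 ≡ r + r
  double = solve-∀

  ∈-board⁺ : ∀ {m s} → Bounded m s → s ∈ board m
  ∈-board⁺ (ri , rj) = ∈-cartesianProduct⁺ (∈-range⁺ ri) (∈-range⁺ rj)

  ∈-board⁻ : ∀ {m s} → s ∈ board m → Bounded m s
  ∈-board⁻ {m} s∈ with i∈ , j∈ ← ∈-cartesianProduct⁻ (range 1 m) (range 1 m) s∈ = ∈-range⁻ i∈ , ∈-range⁻ j∈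

  -- Neither list has repetitions, so equal membership is enough for a permutation.
  white↭diagonals : ∀ m → whiteBoard m ↭ diagonals true 0 m
  white↭diagonals m = ∼bag⇒↭ (unique∧set⇒bag (Unique.filter⁺ even? (board-unique m)) (diagonals-unique true 0 m)
    (mk⇔ to from))
    where
    to : ∀ {s} → s ∈ whiteBoard m → s ∈ diagonals true 0 m
    to {i , j} s∈ with s∈board , divides r eq ← ∈-filter⁻ even? {xs = board m} s∈
      with ri , rj ← subst (λ t → Bounded t (i , j)) (sym (+-identityʳ m)) (∈-board⁻ s∈board)
      = ∈-diagonals-true 0 m i j r ri rj split (trans eq (double r))
      where
      split : j + 0 ≤ i ⊎ i + 1 ≤ j
      split with ≤-<-connex j i
      ... | inj₁ j≤i = inj₁ (≤-trans (≤-reflexive (+-identityʳ j)) j≤i)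
      ... | inj₂ i<j = inj₂ (≤-trans (≤-reflexive (+-comm i 1)) i<j)
    from : ∀ {s} → s ∈ diagonals true 0 m → s ∈ whiteBoard m
    from {i , j} s∈ with shape true 0 m s∈
    ... | (t , _ , eq) , _ = ∈-filter⁺ even? (∈-board⁺ (subst (λ t → Bounded t (i , j)) (+-identityʳ m) (diagonals-bounded true 0 m s∈)))
      (divides (suc t) (trans eq (sym (double (suc t)))))

  black↭diagonals : ∀ m → blackBoard m ↭ diagonals false 0 m
  black↭diagonals m = ∼bag⇒↭ (unique∧set⇒bag (Unique.filter⁺ (¬? ∘ even?) (board-unique m)) (diagonals-unique false 0 m)
    (mk⇔ to from))
    where
    to : ∀ {s} → s ∈ blackBoard m → s ∈ diagonals false 0 m
    to {i , j} s∈ with s∈board , odd ← ∈-filter⁻ (¬? ∘ even?) {xs = board m} s∈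
      with ri , rj ← subst (λ t → Bounded t (i , j)) (sym (+-identityʳ m)) (∈-board⁻ s∈board) with parity (i + j)
    ... | inj₁ (r , eq) = contradiction (divides r (trans eq (sym (double r)))) odd
    ... | inj₂ (r , eq) = ∈-diagonals-false 0 m i j r ri rj (split eq) eq
      where
      split : i + j ≡ suc (r + r) → j + 1 ≤ i ⊎ i + 1 ≤ j
      split eq with <-cmp i j
      ... | tri< i<j _ _ = inj₂ (≤-trans (≤-reflexive (+-comm i 1)) i<j)
      ... | tri≈ _ refl _ = contradiction (sym eq) (odd≢even r i)
      ... | tri> _ _ j<i = inj₁ (≤-trans (≤-reflexive (+-comm j 1)) j<i)
    from : ∀ {s} → s ∈ diagonals false 0 m → s ∈ blackBoard m
    from {i , j} s∈ with shape false 0 m s∈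
    ... | (t , _ , eq) , _ = ∈-filter⁺ (¬? ∘ even?)
      (∈-board⁺ (subst (λ t → Bounded t (i , j)) (+-identityʳ m) (diagonals-bounded false 0 m s∈)))
      λ (divides r eq′) → odd≢even (suc t) r (trans (sym eq) (trans eq′ (double r)))

  R-W≡F : ∀ m k → + R-W m k ≡ F (+ m) (+ extraCells true m) k
  R-W≡F m k = trans
    (cong +_ (trans (placements≡N k (Unique.filter⁺ even? (board-unique m))) (N-↭ k (white↭diagonals m))))
    (N-diagonals true 0 m k)

  R-K≡F : ∀ m k → + R-K m k ≡ F (+ m) (+ extraCells false m) k
  R-K≡F m k = trans
    (cong +_ (trans (placements≡N k (Unique.filter⁺ (¬? ∘ even?) (board-unique m))) (N-↭ k (black↭diagonals m))))
    (N-diagonals false 0 m k)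

  -- Squares on a common diagonal have coordinate sums of the same parity: i - j = i′ - j′ gives (i
  -- + j) + 2j′ = 2j + (i′ + j′).
  even-odd-compatible : ∀ s t → Even s → ¬ Even t → Compatible s t
  even-odd-compatible (i , j) (i′ , j′) even odd (inj₂ eq) = odd (subst (2 ∣_) eq even)
  even-odd-compatible (i , j) (i′ , j′) even odd (inj₁ eq) = odd (∣m+n∣m⇒∣n
    (subst (2 ∣_) (trans (regroup i j j′) (trans (cong (λ t → j + j′ + t) (⊖-≡⇒ i j i′ j′ eq)) (regroup′ i′ j′ j)))
      (∣m∣n⇒∣m+n even (divides j′ (sym (double j′)))))
    (divides j (sym (double j))))
    where
    regroup : ∀ i j j′ → i + j + (j′ + j′) ≡ j + j′ + (i + j′)
    regroup = solve-∀
    regroup′ : ∀ i′ j′ j → j + j′ + (i′ + j) ≡ j + j + (i′ + j′)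
    regroup′ = solve-∀

  -- Bishops on different colours never attack each other, so the placements on the two colours are
  -- independent.
  B-S≡⋆ : ∀ m k → + B-S m k ≡ ((λ j → + R-W m j) ⋆ (λ j → + R-K m j)) k
  B-S≡⋆ m k = begin
    + B-S m k
      ≡⟨ cong +_ (trans (placements≡N k (board-unique m)) (N-↭ k (filter-partition even? (board m)))) ⟩
    + N k (whiteBoard m ++ blackBoard m)
      ≡⟨ N-++ k (whiteBoard m) (All.map (λ {s} even → All.map (λ {t} odd → even-odd-compatible s t even odd)
           (All.all-filter (¬? ∘ even?) (board m))) (All.all-filter even? (board m))) ⟩
    ((λ j → + N j (whiteBoard m)) ⋆ (λ j → + N j (blackBoard m))) k
      ≡⟨ sumTo-cong k (λ j → cong₂ (λ a b → + a ℤ.* + b)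
           (sym (placements≡N j (Unique.filter⁺ even? (board-unique m))))
           (sym (placements≡N (k ∸ j) (Unique.filter⁺ (¬? ∘ even?) (board-unique m))))) ⟩
    ((λ j → + R-W m j) ⋆ (λ j → + R-K m j)) k ∎

module Coefficients where
  open IntegerIdentities using (sumTo; C; ff≡!*C; _⋆_; F; signed-stirling₁; βTerm; sum-sum-βTerm; F-expand)
  open BishopPlacements using (extraCells; R-W≡F; R-K≡F; B-S≡⋆)
  open import Data.Bool.Base using (true; false)
  open import Data.Product.Base using (_×_; _,_; proj₁; proj₂)
  open import Data.Integer.Base as ℤ using (ℤ; +_; 1ℤ; -1ℤ)
  import Data.Integer.Properties as ℤ
  import Data.Integer.Tactic.RingSolver as ℤ
  open import Data.List.Base using (foldr; applyUpTo)
  open import Data.List.Properties using (map-applyUpTo)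
  open import Data.Nat.Base as ℕ using (ℕ; zero; suc; _∸_; _≤_; _<_; z≤n; _!)
  import Data.Nat.Properties as ℕ
  open import Data.Rational.Base using (ℚ; 0ℚ; _/_; _+_; _*_; toℚᵘ)
  open import Data.Rational.Properties
  open import Data.Rational.Solver using (module +-*-Solver)
  open import Data.Rational.Unnormalised.Base as ℚᵘ using (mkℚᵘ; *≡*)
  import Data.Rational.Unnormalised.Properties as ℚᵘ
  open import Function.Base using (_∘_)
  open import Relation.Binary.PropositionalEquality
  open ≡-Reasoning
  open +-*-Solver using (solve; _:=_; _:+_; _:*_)

  -- Passing from integers to rationals.

  ι : ℤ → ℚ
  ι i = i / 1

  -- `_/_` reduces to lowest terms; among unnormalised rationals the given fraction is visible
  -- again, and the equations below become cross multiplications in ℤ.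
  toℚᵘ-/ : ∀ i n → toℚᵘ (i / suc n) ℚᵘ.≃ mkℚᵘ i n
  toℚᵘ-/ i n = toℚᵘ-fromℚᵘ (mkℚᵘ i n)

  ι-+ : ∀ a b → ι (a ℤ.+ b) ≡ ι a + ι b
  ι-+ a b = toℚᵘ-injective (ℚᵘ.≃-trans (toℚᵘ-/ (a ℤ.+ b) 0) (ℚᵘ.≃-trans (*≡* (expand a b))
    (ℚᵘ.≃-sym (ℚᵘ.≃-trans (toℚᵘ-homo-+ (ι a) (ι b)) (ℚᵘ.+-cong (toℚᵘ-/ a 0) (toℚᵘ-/ b 0))))))
    where
    expand : ∀ a b → (a ℤ.+ b) ℤ.* 1ℤ ≡ (a ℤ.* 1ℤ ℤ.+ b ℤ.* 1ℤ) ℤ.* 1ℤ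
    expand = ℤ.solve-∀

  /-*-ι : ∀ a b x n .{{_ : ℕ.NonZero n}} → a ℤ.* b ≡ + n ℤ.* x → (a / n) * ι b ≡ ι x
  /-*-ι a b x (suc n) eq = toℚᵘ-injective (ℚᵘ.≃-trans (toℚᵘ-homo-* (a / suc n) (ι b))
    (ℚᵘ.≃-trans (ℚᵘ.*-cong (toℚᵘ-/ a n) (toℚᵘ-/ b 0))
    (ℚᵘ.≃-trans (*≡* (trans (ℤ.*-identityʳ (a ℤ.* b)) (trans eq (trans (ℤ.*-comm (+ suc n) x)
       (cong (λ t → x ℤ.* + suc t) (sym (ℕ.*-identityʳ n)))))))
    (ℚᵘ.≃-sym (toℚᵘ-/ x 0)))))

  ι-* : ∀ a b → ι (a ℤ.* b) ≡ ι a * ι b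
  ι-* a b = sym (/-*-ι a b (a ℤ.* b) 1 (sym (ℤ.*-identityˡ (a ℤ.* b))))

  /≡1/* : ∀ a n .{{_ : ℕ.NonZero n}} → a / n ≡ (1ℤ / n) * ι a
  /≡1/* a (suc n) = toℚᵘ-injective (ℚᵘ.≃-trans (toℚᵘ-/ a n) (ℚᵘ.≃-trans
    (*≡* (cong₂ ℤ._*_ (sym (ℤ.*-identityˡ a)) (cong (+_ ∘ suc) (ℕ.*-identityʳ n))))
    (ℚᵘ.≃-sym (ℚᵘ.≃-trans (toℚᵘ-homo-* (1ℤ / suc n) (ι a)) (ℚᵘ.*-cong (toℚᵘ-/ 1ℤ n) (toℚᵘ-/ a 0))))))

  1/*ι : ∀ n x .{{_ : ℕ.NonZero n}} → (1ℤ / n) * ι (+ n ℤ.* x) ≡ ι x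
  1/*ι n x = /-*-ι 1ℤ (+ n ℤ.* x) x n (ℤ.*-identityˡ (+ n ℤ.* x))

  binomial≡C : ∀ y n → binomial y n ≡ ι (C y n)
  binomial≡C y n = begin
    (fallingFactorial y n / n !) {{n ℕ.!≢0}}              ≡⟨ /≡1/* (fallingFactorial y n) (n !) {{n ℕ.!≢0}} ⟩
    (1ℤ / n !) {{n ℕ.!≢0}} * ι (fallingFactorial y n)     ≡⟨ cong (λ t → (1ℤ / n !) {{n ℕ.!≢0}} * ι t) (ff≡!*C y n) ⟩
    (1ℤ / n !) {{n ℕ.!≢0}} * ι (+ (n !) ℤ.* C y n)        ≡⟨ 1/*ι (n !) (C y n) {{n ℕ.!≢0}} ⟩
    ι (C y n)                                             ∎

  -- Rational sums over intervals and the exchange of summations.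

  T : ℕ → (ℕ → ℚ) → ℚ
  T n f = foldr _+_ 0ℚ (applyUpTo f n)

  -- With the lower limit moved into the summand, induction runs on the number of terms, and empty
  -- sums need no special care.
  ∑≡T : ∀ lo hi f → ∑ lo hi f ≡ T (suc hi ∸ lo) (λ t → f (lo ℕ.+ t))
  ∑≡T lo hi f = cong (foldr _+_ 0ℚ) (map-applyUpTo (lo ℕ.+_) f (suc hi ∸ lo))

  T-cong : ∀ n {f g} → (∀ i → f i ≡ g i) → T n f ≡ T n g
  T-cong zero    f≗g = refl
  T-cong (suc n) f≗g = cong₂ _+_ (f≗g 0) (T-cong n (f≗g ∘ suc))

  T-snoc : ∀ n f → T (suc n) f ≡ T n f + f n
  T-snoc zero    f = +-comm (f 0) 0ℚ
  T-snoc (suc n) f = trans (cong (λ t → f 0 + t) (T-snoc n (f ∘ suc))) (sym (+-assoc (f 0) (T n (f ∘ suc)) (f (suc n))))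

  T-+ : ∀ n f g → T n (λ i → f i + g i) ≡ T n f + T n g
  T-+ zero    f g = refl
  T-+ (suc n) f g = trans (cong (λ t → f 0 + g 0 + t) (T-+ n (f ∘ suc) (g ∘ suc)))
    (medial (f 0) (g 0) (T n (f ∘ suc)) (T n (g ∘ suc)))
    where
    medial : ∀ a b c d → a + b + (c + d) ≡ a + c + (b + d)
    medial = solve 4 (λ a b c d → a :+ b :+ (c :+ d) := a :+ c :+ (b :+ d)) refl

  T-*ˡ : ∀ n c f → T n (λ i → c * f i) ≡ c * T n f
  T-*ˡ zero    c f = sym (*-zeroʳ c)
  T-*ˡ (suc n) c f = trans (cong (λ t → c * f 0 + t) (T-*ˡ n c (f ∘ suc))) (sym (*-distribˡ-+ c (f 0) (T n (f ∘ suc))))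

  T-zero : ∀ n → T n (λ _ → 0ℚ) ≡ 0ℚ
  T-zero zero    = refl
  T-zero (suc n) = trans (+-identityˡ (T n (λ _ → 0ℚ))) (T-zero n)

  T-swap : ∀ n m (f : ℕ → ℕ → ℚ) → T n (λ i → T m (f i)) ≡ T m (λ j → T n (λ i → f i j))
  T-swap zero    m f = sym (T-zero m)
  T-swap (suc n) m f = trans (cong (λ t → T m (f 0) + t) (T-swap n m (f ∘ suc)))
    (sym (T-+ m (f 0) (λ j → T n (λ i → f (suc i) j))))

  ∑-cong : ∀ lo hi {f g} → (∀ i → f i ≡ g i) → ∑ lo hi f ≡ ∑ lo hi g
  ∑-cong lo hi {f} {g} f≗g = trans (∑≡T lo hi f) (trans (T-cong (suc hi ∸ lo) (λ t → f≗g (lo ℕ.+ t))) (sym (∑≡T lo hi g)))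

  ∑-+ : ∀ lo hi f g → (∑ lo hi λ i → f i + g i) ≡ ∑ lo hi f + ∑ lo hi g
  ∑-+ lo hi f g = trans (∑≡T lo hi (λ i → f i + g i)) (trans (T-+ (suc hi ∸ lo) (λ t → f (lo ℕ.+ t)) (λ t → g (lo ℕ.+ t)))
    (sym (cong₂ _+_ (∑≡T lo hi f) (∑≡T lo hi g))))

  ∑-*ˡ : ∀ lo hi c f → (∑ lo hi λ i → c * f i) ≡ c * ∑ lo hi f
  ∑-*ˡ lo hi c f = trans (∑≡T lo hi (λ i → c * f i)) (trans (T-*ˡ (suc hi ∸ lo) c (λ t → f (lo ℕ.+ t)))
    (cong (c *_) (sym (∑≡T lo hi f))))

  ∑-*ʳ : ∀ lo hi c f → (∑ lo hi λ i → f i * c) ≡ ∑ lo hi f * c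
  ∑-*ʳ lo hi c f = trans (∑-cong lo hi (λ i → *-comm (f i) c)) (trans (∑-*ˡ lo hi c f) (*-comm c (∑ lo hi f)))

  ∑-swap : ∀ lo hi lo′ hi′ (f : ℕ → ℕ → ℚ) →
           (∑ lo hi λ i → ∑ lo′ hi′ (f i)) ≡ (∑ lo′ hi′ λ j → ∑ lo hi λ i → f i j)
  ∑-swap lo hi lo′ hi′ f = begin
    (∑ lo hi λ i → ∑ lo′ hi′ (f i))
      ≡⟨ ∑≡T lo hi (λ i → ∑ lo′ hi′ (f i)) ⟩
    T n (λ i → ∑ lo′ hi′ (f (lo ℕ.+ i)))
      ≡⟨ T-cong n (λ i → ∑≡T lo′ hi′ (f (lo ℕ.+ i))) ⟩
    T n (λ i → T n′ (λ j → f (lo ℕ.+ i) (lo′ ℕ.+ j)))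
      ≡⟨ T-swap n n′ (λ i j → f (lo ℕ.+ i) (lo′ ℕ.+ j)) ⟩
    T n′ (λ j → T n (λ i → f (lo ℕ.+ i) (lo′ ℕ.+ j)))
      ≡⟨ T-cong n′ (λ j → ∑≡T lo hi (λ i → f i (lo′ ℕ.+ j))) ⟨
    T n′ (λ j → ∑ lo hi λ i → f i (lo′ ℕ.+ j))
      ≡⟨ ∑≡T lo′ hi′ (λ j → ∑ lo hi λ i → f i j) ⟨
    (∑ lo′ hi′ λ j → ∑ lo hi λ i → f i j) ∎
    where
    n  = suc hi ∸ lo
    n′ = suc hi′ ∸ lo′

  ∑-empty : ∀ {lo hi} f → hi < lo → ∑ lo hi f ≡ 0ℚ
  ∑-empty {lo} {hi} f hi<lo = trans (∑≡T lo hi f) (cong (λ n → T n (λ t → f (lo ℕ.+ t))) (ℕ.m≤n⇒m∸n≡0 hi<lo))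

  ∑-snoc : ∀ {lo hi} f → lo ≤ suc hi → ∑ lo (suc hi) f ≡ ∑ lo hi f + f (suc hi)
  ∑-snoc {lo} {hi} f lo≤ = begin
    ∑ lo (suc hi) f                                       ≡⟨ ∑≡T lo (suc hi) f ⟩
    T (suc (suc hi) ∸ lo) g                               ≡⟨ cong (λ n → T n g) (ℕ.+-∸-assoc 1 lo≤) ⟩
    T (suc (suc hi ∸ lo)) g                               ≡⟨ T-snoc (suc hi ∸ lo) g ⟩
    T (suc hi ∸ lo) g + f (lo ℕ.+ (suc hi ∸ lo))          ≡⟨ cong₂ (λ a b → a + f b) (sym (∑≡T lo hi f)) (ℕ.m+[n∸m]≡n lo≤) ⟩
    ∑ lo hi f + f (suc hi)                                ∎
    where
    g : ℕ → ℚ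
    g t = f (lo ℕ.+ t)

  ∑-single : ∀ n f → ∑ n n f ≡ f n
  ∑-single zero    f = +-identityʳ (f 0)
  ∑-single (suc n) f = trans (∑-snoc {hi = n} f ℕ.≤-refl)
    (trans (cong (_+ f (suc n)) (∑-empty f (ℕ.n<1+n n))) (+-identityˡ (f (suc n))))

  ∑-cong≤ : ∀ n {f g} → (∀ i → i ≤ n → f i ≡ g i) → ∑ 0 n f ≡ ∑ 0 n g
  ∑-cong≤ zero    {f} {g} f≗g = trans (∑-single 0 f) (trans (f≗g 0 z≤n) (sym (∑-single 0 g)))
  ∑-cong≤ (suc n) {f} {g} f≗g = trans (∑-snoc f z≤n) (trans
    (cong₂ _+_ (∑-cong≤ n (λ i i≤n → f≗g i (ℕ.m≤n⇒m≤1+n i≤n))) (f≗g (suc n) ℕ.≤-refl)) (sym (∑-snoc g z≤n)))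

  ∑-ι : ∀ n f → (∑ 0 n λ i → ι (f i)) ≡ ι (sumTo n f)
  ∑-ι zero    f = ∑-single 0 (ι ∘ f)
  ∑-ι (suc n) f = trans (∑-snoc (ι ∘ f) z≤n) (trans (cong (_+ ι (f (suc n))) (∑-ι n f)) (sym (ι-+ (sumTo n f) (f (suc n)))))

  -- Both sides run over the pairs with 0 ≤ p ≤ h and 0 ≤ i ≤ p + k. Passing to h + 1 brings one new
  -- i, namely h + 1 + k, whose inner sum is the single term p = h + 1. The pairs are (i, b) in
  -- `sum-β` and (i, p) in `polynomial≡F`.
  ∑-exchange : ∀ h k (f : ℕ → ℕ → ℚ) →
               (∑ 0 (h ℕ.+ k) λ i → ∑ (i ∸ k) h (f i)) ≡ (∑ 0 h λ p → ∑ 0 (p ℕ.+ k) λ i → f i p)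
  ∑-exchange zero k f = begin
    (∑ 0 k λ i → ∑ (i ∸ k) 0 (f i))      ≡⟨ ∑-cong≤ k (λ i i≤k → trans (cong (λ lo → ∑ lo 0 (f i)) (ℕ.m≤n⇒m∸n≡0 i≤k)) (∑-single 0 (f i))) ⟩
    (∑ 0 k λ i → f i 0)                  ≡⟨ ∑-single 0 (λ p → ∑ 0 (p ℕ.+ k) λ i → f i p) ⟨
    (∑ 0 0 λ p → ∑ 0 (p ℕ.+ k) λ i → f i p) ∎
  ∑-exchange (suc h) k f = begin
    (∑ 0 (suc h ℕ.+ k) λ i → ∑ (i ∸ k) (suc h) (f i))
      ≡⟨ ∑-snoc (λ i → ∑ (i ∸ k) (suc h) (f i)) z≤n ⟩
    (∑ 0 (h ℕ.+ k) λ i → ∑ (i ∸ k) (suc h) (f i)) + ∑ (suc h ℕ.+ k ∸ k) (suc h) (f (suc h ℕ.+ k))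
      ≡⟨ cong₂ _+_ (∑-cong≤ (h ℕ.+ k) (λ i i≤h+k → ∑-snoc (f i)
             (ℕ.m≤n⇒m≤1+n (ℕ.≤-trans (ℕ.∸-monoˡ-≤ k i≤h+k) (ℕ.≤-reflexive (ℕ.m+n∸n≡m h k))))))
           (trans (cong (λ lo → ∑ lo (suc h) (f (suc h ℕ.+ k))) (ℕ.m+n∸n≡m (suc h) k)) (∑-single (suc h) (f (suc h ℕ.+ k)))) ⟩
    (∑ 0 (h ℕ.+ k) λ i → ∑ (i ∸ k) h (f i) + f i (suc h)) + f (suc h ℕ.+ k) (suc h)
      ≡⟨ cong (_+ f (suc h ℕ.+ k) (suc h)) (∑-+ 0 (h ℕ.+ k) (λ i → ∑ (i ∸ k) h (f i)) (λ i → f i (suc h))) ⟩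
    (∑ 0 (h ℕ.+ k) λ i → ∑ (i ∸ k) h (f i)) + (∑ 0 (h ℕ.+ k) λ i → f i (suc h)) + f (suc h ℕ.+ k) (suc h)
      ≡⟨ +-assoc (∑ 0 (h ℕ.+ k) λ i → ∑ (i ∸ k) h (f i)) (∑ 0 (h ℕ.+ k) λ i → f i (suc h)) (f (suc h ℕ.+ k) (suc h)) ⟩
    (∑ 0 (h ℕ.+ k) λ i → ∑ (i ∸ k) h (f i)) + ((∑ 0 (h ℕ.+ k) λ i → f i (suc h)) + f (suc h ℕ.+ k) (suc h))
      ≡⟨ cong₂ _+_ (∑-exchange h k f) (sym (∑-snoc (λ i → f i (suc h)) z≤n)) ⟩
    (∑ 0 h λ p → ∑ 0 (p ℕ.+ k) λ i → f i p) + (∑ 0 (suc h ℕ.+ k) λ i → f i (suc h))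
      ≡⟨ ∑-snoc (λ p → ∑ 0 (p ℕ.+ k) λ i → f i p) z≤n ⟨
    (∑ 0 (suc h) λ p → ∑ 0 (p ℕ.+ k) λ i → f i p) ∎

  ∑-triangle : ∀ n (f : ℕ → ℕ → ℚ) → (∑ 0 n λ i → ∑ i n (f i)) ≡ (∑ 0 n λ p → ∑ 0 p λ i → f i p)
  ∑-triangle n f = begin
    (∑ 0 n λ i → ∑ i n (f i))                  ≡⟨ cong (λ t → ∑ 0 t λ i → ∑ i n (f i)) (ℕ.+-identityʳ n) ⟨
    (∑ 0 (n ℕ.+ 0) λ i → ∑ i n (f i))          ≡⟨ ∑-exchange n 0 f ⟩
    (∑ 0 n λ p → ∑ 0 (p ℕ.+ 0) λ i → f i p)    ≡⟨ ∑-cong 0 n (λ p → cong (λ t → ∑ 0 t λ i → f i p) (ℕ.+-identityʳ p)) ⟩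
    (∑ 0 n λ p → ∑ 0 p λ i → f i p)            ∎

  -- The coefficients and the count for one colour.

  pos-^ : ∀ m n → + (m ℕ.^ n) ≡ (+ m) ℤ.^ n
  pos-^ m zero    = refl
  pos-^ m (suc n) = trans (ℤ.pos-* m (m ℕ.^ n)) (cong (+ m ℤ.*_) (pos-^ m n))

  β≡ : ∀ i p q z → β i p q z ≡ (1ℤ / 2 ℕ.^ (2 ℕ.* q)) {{ℕ.m^n≢0 2 (2 ℕ.* q)}} * ∑ (i ∸ p) q (λ b → ι (βTerm i p q z b))
  β≡ i p q z = cong ((1ℤ / 2 ℕ.^ (2 ℕ.* q)) {{ℕ.m^n≢0 2 (2 ℕ.* q)}} *_) (∑-cong (i ∸ p) q λ b → sym (begin
    ι (βTerm i p q z b)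
      ≡⟨ ι-* ((+ 2) ℤ.^ b ℤ.* C (+ (2 ℕ.* q) ℤ.- + b) q) (sumTo b (inner b)) ⟩
    ι ((+ 2) ℤ.^ b ℤ.* C (+ (2 ℕ.* q) ℤ.- + b) q) * ι (sumTo b (inner b))
      ≡⟨ cong₂ _*_
           (trans (ι-* ((+ 2) ℤ.^ b) (C (+ (2 ℕ.* q) ℤ.- + b) q))
             (cong₂ _*_ (cong ι (sym (pos-^ 2 b))) (sym (binomial≡C (+ (2 ℕ.* q) ℤ.- + b) q))))
           (trans (sym (∑-ι b (inner b))) (∑-cong 0 b λ a →
             trans (ι-* (C (u b) a ℤ.* C (+ q ℤ.+ z) (b ∸ a)) (C (+ a ℤ.- + q) (p ℕ.+ b ∸ i)))
               (cong₂ _*_ (trans (ι-* (C (u b) a) (C (+ q ℤ.+ z) (b ∸ a)))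
                                 (cong₂ _*_ (sym (binomial≡C (u b) a)) (sym (binomial≡C (+ q ℤ.+ z) (b ∸ a)))))
                          (sym (binomial≡C (+ a ℤ.- + q) (p ℕ.+ b ∸ i)))))) ⟩
    fromℕ (2 ℕ.^ b) * binomial (+ (2 ℕ.* q) ℤ.- + b) q *
      (∑ 0 b λ a → binomial (u b) a * binomial (+ q ℤ.+ z) (b ∸ a) * binomial (+ a ℤ.- + q) (p ℕ.+ b ∸ i)) ∎))
    where
    u : ℕ → ℤ
    u b = + p ℤ.+ + b ℤ.- + q ℤ.- z
    inner : ℕ → ℕ → ℤ
    inner b a = C (u b) a ℤ.* C (+ q ℤ.+ z) (b ∸ a) ℤ.* C (+ a ℤ.- + q) (p ℕ.+ b ∸ i)

  -- The lower limit of the sum over b depends on i; exchanging the sums gives each b the range 0 ≤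
  -- i ≤ p + b, the one of `sum-βTerm`. The resulting 4^q cancels the denominator 2^(2q) of `β`.
  sum-β : ∀ m y z p q → + m ℤ.- z ≡ + 2 ℤ.* + y →
          (∑ 0 (q ℕ.+ p) λ i → ι (C (+ m) i) * β i p q z) ≡ ι (C (+ m ℤ.- + q) p ℤ.* C (+ y) q)
  sum-β m y z p q m-z≡2y = begin
    (∑ 0 (q ℕ.+ p) λ i → ι (C (+ m) i) * β i p q z)
      ≡⟨ ∑-cong 0 (q ℕ.+ p) (λ i → trans (cong (ι (C (+ m) i) *_) (β≡ i p q z)) (trans
           (exchange (ι (C (+ m) i)) w (∑ (i ∸ p) q λ b → ι (βTerm i p q z b)))
           (cong (w *_) (trans (sym (∑-*ˡ (i ∸ p) q (ι (C (+ m) i)) λ b → ι (βTerm i p q z b)))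
             (∑-cong (i ∸ p) q λ b → sym (ι-* (C (+ m) i) (βTerm i p q z b))))))) ⟩
    (∑ 0 (q ℕ.+ p) λ i → w * ∑ (i ∸ p) q λ b → ι (g i b))
      ≡⟨ ∑-*ˡ 0 (q ℕ.+ p) w (λ i → ∑ (i ∸ p) q λ b → ι (g i b)) ⟩
    w * (∑ 0 (q ℕ.+ p) λ i → ∑ (i ∸ p) q λ b → ι (g i b))
      ≡⟨ cong (w *_) (begin
           (∑ 0 (q ℕ.+ p) λ i → ∑ (i ∸ p) q λ b → ι (g i b))
             ≡⟨ ∑-exchange q p (λ i b → ι (g i b)) ⟩
           (∑ 0 q λ b → ∑ 0 (b ℕ.+ p) λ i → ι (g i b))
             ≡⟨ ∑-cong 0 q (λ b → trans (∑-ι (b ℕ.+ p) (λ i → g i b)) (cong (λ t → ι (sumTo t λ i → g i b)) (ℕ.+-comm b p))) ⟩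
           (∑ 0 q λ b → ι (sumTo (p ℕ.+ b) λ i → g i b))
             ≡⟨ ∑-ι q (λ b → sumTo (p ℕ.+ b) λ i → g i b) ⟩
           ι (sumTo q λ b → sumTo (p ℕ.+ b) λ i → g i b)
             ≡⟨ cong ι (trans (sum-sum-βTerm m y p q z m-z≡2y)
                  (cong (ℤ._* (C (+ m ℤ.- + q) p ℤ.* C (+ y) q))
                    (trans (sym (pos-^ 4 q)) (cong +_ (ℕ.^-*-assoc 2 2 q))))) ⟩
           ι (+ (2 ℕ.^ (2 ℕ.* q)) ℤ.* (C (+ m ℤ.- + q) p ℤ.* C (+ y) q)) ∎) ⟩
    w * ι (+ (2 ℕ.^ (2 ℕ.* q)) ℤ.* (C (+ m ℤ.- + q) p ℤ.* C (+ y) q))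
      ≡⟨ 1/*ι (2 ℕ.^ (2 ℕ.* q)) (C (+ m ℤ.- + q) p ℤ.* C (+ y) q) {{ℕ.m^n≢0 2 (2 ℕ.* q)}} ⟩
    ι (C (+ m ℤ.- + q) p ℤ.* C (+ y) q) ∎
    where
    w = (1ℤ / 2 ℕ.^ (2 ℕ.* q)) {{ℕ.m^n≢0 2 (2 ℕ.* q)}}
    g : ℕ → ℕ → ℤ
    g i b = C (+ m) i ℤ.* βTerm i p q z b
    exchange : ∀ a b c → a * (b * c) ≡ b * (a * c)
    exchange = solve 3 (λ a b c → a :* (b :* c) := b :* (a :* c)) refl

  inverse-! : ℕ → ℚ
  inverse-! i = (1ℤ / i !) {{i ℕ.!≢0}}

  stirling-weight : ℕ → ℕ → ℚ
  stirling-weight i d = ((-1ℤ ℤ.^ (i ∸ d)) / i !) {{i ℕ.!≢0}} * fromℕ (stirling₁ i d)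

  sum-stirling : ∀ m i → (∑ 0 i λ d → stirling-weight i d * fromℕ (m ℕ.^ d)) ≡ ι (C (+ m) i)
  sum-stirling m i = begin
    (∑ 0 i λ d → stirling-weight i d * fromℕ (m ℕ.^ d))
      ≡⟨ ∑-cong 0 i term ⟩
    (∑ 0 i λ d → inverse-! i * ι (g d))
      ≡⟨ ∑-*ˡ 0 i (inverse-! i) (ι ∘ g) ⟩
    inverse-! i * (∑ 0 i λ d → ι (g d))
      ≡⟨ cong (inverse-! i *_) (trans (∑-ι i g) (cong ι (trans (signed-stirling₁ (+ m) i) (ff≡!*C (+ m) i)))) ⟩
    inverse-! i * ι (+ (i !) ℤ.* C (+ m) i)
      ≡⟨ 1/*ι (i !) (C (+ m) i) {{i ℕ.!≢0}} ⟩
    ι (C (+ m) i) ∎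
    where
    g : ℕ → ℤ
    g d = -1ℤ ℤ.^ (i ∸ d) ℤ.* + stirling₁ i d ℤ.* (+ m) ℤ.^ d
    reassociate : ∀ w s t m → w * s * t * m ≡ w * (s * t * m)
    reassociate = solve 4 (λ w s t m → w :* s :* t :* m := w :* (s :* t :* m)) refl
    term : ∀ d → stirling-weight i d * fromℕ (m ℕ.^ d) ≡ inverse-! i * ι (g d)
    term d = begin
      stirling-weight i d * fromℕ (m ℕ.^ d)
        ≡⟨ cong₂ (λ a b → a * fromℕ (stirling₁ i d) * ι b) (/≡1/* (-1ℤ ℤ.^ (i ∸ d)) (i !) {{i ℕ.!≢0}}) (pos-^ m d) ⟩
      inverse-! i * ι (-1ℤ ℤ.^ (i ∸ d)) * ι (+ stirling₁ i d) * ι ((+ m) ℤ.^ d)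
        ≡⟨ reassociate (inverse-! i) (ι (-1ℤ ℤ.^ (i ∸ d))) (ι (+ stirling₁ i d)) (ι ((+ m) ℤ.^ d)) ⟩
      inverse-! i * (ι (-1ℤ ℤ.^ (i ∸ d)) * ι (+ stirling₁ i d) * ι ((+ m) ℤ.^ d))
        ≡⟨ cong (inverse-! i *_) (trans (ι-* (-1ℤ ℤ.^ (i ∸ d) ℤ.* + stirling₁ i d) ((+ m) ℤ.^ d))
             (cong (_* ι ((+ m) ℤ.^ d)) (ι-* (-1ℤ ℤ.^ (i ∸ d)) (+ stirling₁ i d)))) ⟨
      inverse-! i * ι (g d) ∎

  inner : ℕ → ℤ → ℕ → ℚ
  inner k z i = ∑ (i ∸ k) k λ p → ∑ p k λ j → fromℕ (assocStirling₂ (p ℕ.+ j) p) * β i (p ℕ.+ j) (k ∸ j) z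

  -- Summing over d against the signed Stirling numbers turns powers of m into binomials.
  polynomial≡binomials : ∀ m k z →
    (∑ 0 (2 ℕ.* k) λ d → coefficient d k z * fromℕ (m ℕ.^ d)) ≡ (∑ 0 (2 ℕ.* k) λ i → ι (C (+ m) i) * inner k z i)
  polynomial≡binomials m k z = begin
    (∑ 0 n λ d → coefficient d k z * M d)
      ≡⟨ ∑-cong 0 n (λ d → trans (sym (∑-*ʳ d n (M d) (λ i → stirling-weight i d * inner k z i)))
           (∑-cong d n λ i → rotate (stirling-weight i d) (inner k z i) (M d))) ⟩
    (∑ 0 n λ d → ∑ d n λ i → stirling-weight i d * M d * inner k z i)
      ≡⟨ ∑-triangle n (λ d i → stirling-weight i d * M d * inner k z i) ⟩
    (∑ 0 n λ i → ∑ 0 i λ d → stirling-weight i d * M d * inner k z i)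
      ≡⟨ ∑-cong 0 n (λ i → trans (∑-*ʳ 0 i (inner k z i) (λ d → stirling-weight i d * M d))
           (cong (_* inner k z i) (sum-stirling m i))) ⟩
    (∑ 0 n λ i → ι (C (+ m) i) * inner k z i) ∎
    where
    n = 2 ℕ.* k
    M : ℕ → ℚ
    M d = fromℕ (m ℕ.^ d)
    rotate : ∀ a b c → a * b * c ≡ a * c * b
    rotate = solve 3 (λ a b c → a :* b :* c := a :* c :* b) refl

  -- The condition i - k ≤ p in the coefficients means i ≤ p + k, and p + k = (k - j) + (p + j) is
  -- the full range of i for β with arguments p + j and k - j. So each pair (p, j) contributes one
  -- sum evaluated by `sum-β`, and `F-expand` collects them.
  polynomial≡F : ∀ m y k z → + m ℤ.- z ≡ + 2 ℤ.* + y →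
    (∑ 0 (2 ℕ.* k) λ d → coefficient d k z * fromℕ (m ℕ.^ d)) ≡ ι (F (+ m) (+ y) k)
  polynomial≡F m y k z m-z≡2y = begin
    (∑ 0 (2 ℕ.* k) λ d → coefficient d k z * fromℕ (m ℕ.^ d))
      ≡⟨ polynomial≡binomials m k z ⟩
    (∑ 0 (2 ℕ.* k) λ i → ι (C (+ m) i) * inner k z i)
      ≡⟨ cong (λ n → ∑ 0 n λ i → ι (C (+ m) i) * inner k z i) (cong (k ℕ.+_) (ℕ.+-identityʳ k)) ⟩
    (∑ 0 (k ℕ.+ k) λ i → ι (C (+ m) i) * inner k z i)
      ≡⟨ ∑-cong 0 (k ℕ.+ k) distribute ⟩
    (∑ 0 (k ℕ.+ k) λ i → ∑ (i ∸ k) k λ p → ∑ p k λ j → a p j * h i p j)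
      ≡⟨ ∑-exchange k k (λ i p → ∑ p k λ j → a p j * h i p j) ⟩
    (∑ 0 k λ p → ∑ 0 (p ℕ.+ k) λ i → ∑ p k λ j → a p j * h i p j)
      ≡⟨ ∑-cong 0 k (λ p → trans (∑-swap 0 (p ℕ.+ k) p k (λ i j → a p j * h i p j))
           (∑-cong p k λ j → ∑-*ˡ 0 (p ℕ.+ k) (a p j) (λ i → h i p j))) ⟩
    (∑ 0 k λ p → ∑ p k λ j → a p j * (∑ 0 (p ℕ.+ k) λ i → h i p j))
      ≡⟨ ∑-triangle k (λ p j → a p j * (∑ 0 (p ℕ.+ k) λ i → h i p j)) ⟩
    (∑ 0 k λ j → ∑ 0 j λ p → a p j * (∑ 0 (p ℕ.+ k) λ i → h i p j))
      ≡⟨ ∑-cong≤ k (λ j j≤k → ∑-cong 0 j λ p → evaluate j j≤k p) ⟩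
    (∑ 0 k λ j → ∑ 0 j λ p → ι (e j p))
      ≡⟨ trans (∑-cong 0 k λ j → ∑-ι j (e j)) (∑-ι k λ j → sumTo j (e j)) ⟩
    ι (sumTo k λ j → sumTo j (e j))
      ≡⟨ cong ι (F-expand (+ m) (+ y) k) ⟩
    ι (F (+ m) (+ y) k) ∎
    where
    a : ℕ → ℕ → ℚ
    a p j = fromℕ (assocStirling₂ (p ℕ.+ j) p)
    h : ℕ → ℕ → ℕ → ℚ
    h i p j = ι (C (+ m) i) * β i (p ℕ.+ j) (k ∸ j) z
    e : ℕ → ℕ → ℤ
    e j p = + assocStirling₂ (p ℕ.+ j) p ℤ.* (C (+ m ℤ.- + (k ∸ j)) (p ℕ.+ j) ℤ.* C (+ y) (k ∸ j))
    exchange : ∀ a b c → a * (b * c) ≡ b * (a * c)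
    exchange = solve 3 (λ a b c → a :* (b :* c) := b :* (a :* c)) refl
    distribute : ∀ i → ι (C (+ m) i) * inner k z i ≡ (∑ (i ∸ k) k λ p → ∑ p k λ j → a p j * h i p j)
    distribute i = trans
      (sym (∑-*ˡ (i ∸ k) k (ι (C (+ m) i)) (λ p → ∑ p k λ j → a p j * β i (p ℕ.+ j) (k ∸ j) z)))
      (∑-cong (i ∸ k) k λ p → trans
        (sym (∑-*ˡ p k (ι (C (+ m) i)) (λ j → a p j * β i (p ℕ.+ j) (k ∸ j) z)))
        (∑-cong p k λ j → exchange (ι (C (+ m) i)) (a p j) (β i (p ℕ.+ j) (k ∸ j) z)))
    split : ∀ j → j ≤ k → ∀ p → p ℕ.+ k ≡ k ∸ j ℕ.+ (p ℕ.+ j)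
    split j j≤k p = begin
      p ℕ.+ k                   ≡⟨ cong (p ℕ.+_) (ℕ.m∸n+n≡m j≤k) ⟨
      p ℕ.+ (k ∸ j ℕ.+ j)       ≡⟨ ℕ.+-assoc p (k ∸ j) j ⟨
      p ℕ.+ (k ∸ j) ℕ.+ j       ≡⟨ cong (ℕ._+ j) (ℕ.+-comm p (k ∸ j)) ⟩
      k ∸ j ℕ.+ p ℕ.+ j         ≡⟨ ℕ.+-assoc (k ∸ j) p j ⟩
      k ∸ j ℕ.+ (p ℕ.+ j)       ∎
    evaluate : ∀ j → j ≤ k → ∀ p → a p j * (∑ 0 (p ℕ.+ k) λ i → h i p j) ≡ ι (e j p)
    evaluate j j≤k p = trans
      (cong (a p j *_) (trans (cong (λ n → ∑ 0 n λ i → h i p j) (split j j≤k p))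
                              (sum-β m y z (p ℕ.+ j) (k ∸ j) m-z≡2y)))
      (sym (ι-* (+ assocStirling₂ (p ℕ.+ j) p) (C (+ m ℤ.- + (k ∸ j)) (p ℕ.+ j) ℤ.* C (+ y) (k ∸ j))))

  -- Products of polynomials and the whole board.

  ∑-truncate : ∀ m n f → (∀ i → n < i → f i ≡ 0ℚ) → ∑ 0 (m ℕ.+ n) f ≡ ∑ 0 n f
  ∑-truncate zero    n f f≗0 = refl
  ∑-truncate (suc m) n f f≗0 = trans (∑-snoc f z≤n) (trans
    (cong₂ _+_ (∑-truncate m n f f≗0) (f≗0 (suc (m ℕ.+ n)) (ℕ.s≤s (ℕ.m≤n+m n m)))) (+-identityʳ (∑ 0 n f)))

  ∑-reindex : ∀ i n f → i ≤ n → (∑ i n λ d → f (d ∸ i)) ≡ ∑ 0 (n ∸ i) f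
  ∑-reindex i n f i≤n = begin
    (∑ i n λ d → f (d ∸ i))                    ≡⟨ ∑≡T i n (λ d → f (d ∸ i)) ⟩
    T (suc n ∸ i) (λ t → f (i ℕ.+ t ∸ i))      ≡⟨ T-cong (suc n ∸ i) (λ t → cong f (ℕ.m+n∸m≡n i t)) ⟩
    T (suc n ∸ i) f                            ≡⟨ cong (λ t → T t f) (ℕ.+-∸-assoc 1 i≤n) ⟩
    T (suc (n ∸ i)) f                          ≡⟨ ∑≡T 0 (n ∸ i) f ⟨
    ∑ 0 (n ∸ i) f                              ∎

  -- A Cauchy product. As f and g vanish beyond A and B, the triangle of index pairs with sum at
  -- most A + B and the rectangle A × B carry the same nonzero terms.
  ∑-product : ∀ A B f g → (∀ i → A < i → f i ≡ 0ℚ) → (∀ i → B < i → g i ≡ 0ℚ) →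
    (∑ 0 (B ℕ.+ A) λ d → ∑ 0 d λ i → f i * g (d ∸ i)) ≡ ∑ 0 A f * ∑ 0 B g
  ∑-product A B f g f≗0 g≗0 = begin
    (∑ 0 (B ℕ.+ A) λ d → ∑ 0 d λ i → f i * g (d ∸ i))
      ≡⟨ ∑-triangle (B ℕ.+ A) (λ i d → f i * g (d ∸ i)) ⟨
    (∑ 0 (B ℕ.+ A) λ i → ∑ i (B ℕ.+ A) λ d → f i * g (d ∸ i))
      ≡⟨ ∑-cong≤ (B ℕ.+ A) (λ i i≤ → trans (∑-*ˡ i (B ℕ.+ A) (f i) (λ d → g (d ∸ i)))
           (cong (f i *_) (∑-reindex i (B ℕ.+ A) g i≤))) ⟩
    (∑ 0 (B ℕ.+ A) λ i → f i * ∑ 0 (B ℕ.+ A ∸ i) g)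
      ≡⟨ ∑-truncate B A (λ i → f i * ∑ 0 (B ℕ.+ A ∸ i) g)
           (λ i A<i → trans (cong (_* ∑ 0 (B ℕ.+ A ∸ i) g) (f≗0 i A<i)) (*-zeroˡ (∑ 0 (B ℕ.+ A ∸ i) g))) ⟩
    (∑ 0 A λ i → f i * ∑ 0 (B ℕ.+ A ∸ i) g)
      ≡⟨ ∑-cong≤ A (λ i i≤A → cong (f i *_) (trans
           (cong (λ n → ∑ 0 n g) (trans (ℕ.+-∸-assoc B i≤A) (ℕ.+-comm B (A ∸ i)))) (∑-truncate (A ∸ i) B g g≗0))) ⟩
    (∑ 0 A λ i → f i * ∑ 0 B g)
      ≡⟨ ∑-*ʳ 0 A (∑ 0 B g) f ⟩
    ∑ 0 A f * ∑ 0 B g ∎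

  polynomial-product : ∀ m A B (c c′ : ℕ → ℚ) → (∀ i → A < i → c i ≡ 0ℚ) → (∀ i → B < i → c′ i ≡ 0ℚ) →
    (∑ 0 (B ℕ.+ A) λ d → (∑ 0 d λ i → c i * c′ (d ∸ i)) * fromℕ (m ℕ.^ d))
    ≡ (∑ 0 A λ i → c i * fromℕ (m ℕ.^ i)) * (∑ 0 B λ i → c′ i * fromℕ (m ℕ.^ i))
  polynomial-product m A B c c′ c≗0 c′≗0 = trans
    (∑-cong 0 (B ℕ.+ A) λ d → trans (sym (∑-*ʳ 0 d (M d) (λ i → c i * c′ (d ∸ i))))
      (∑-cong≤ d λ i i≤d → trans (cong (c i * c′ (d ∸ i) *_) (power i d i≤d)) (medial (c i) (c′ (d ∸ i)) (M i) (M (d ∸ i)))))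
    (∑-product A B (λ i → c i * M i) (λ i → c′ i * M i) (vanish {c = c} c≗0) (vanish {c = c′} c′≗0))
    where
    M : ℕ → ℚ
    M d = fromℕ (m ℕ.^ d)
    medial : ∀ a b c d → a * b * (c * d) ≡ a * c * (b * d)
    medial = solve 4 (λ a b c d → a :* b :* (c :* d) := a :* c :* (b :* d)) refl
    power : ∀ i d → i ≤ d → M d ≡ M i * M (d ∸ i)
    power i d i≤d = begin
      fromℕ (m ℕ.^ d)                            ≡⟨ cong (λ t → fromℕ (m ℕ.^ t)) (ℕ.m+[n∸m]≡n i≤d) ⟨
      fromℕ (m ℕ.^ (i ℕ.+ (d ∸ i)))              ≡⟨ cong fromℕ (ℕ.^-distribˡ-+-* m i (d ∸ i)) ⟩
      fromℕ (m ℕ.^ i ℕ.* m ℕ.^ (d ∸ i))          ≡⟨ cong ι (ℤ.pos-* (m ℕ.^ i) (m ℕ.^ (d ∸ i))) ⟩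
      ι (+ (m ℕ.^ i) ℤ.* + (m ℕ.^ (d ∸ i)))      ≡⟨ ι-* (+ (m ℕ.^ i)) (+ (m ℕ.^ (d ∸ i))) ⟩
      M i * M (d ∸ i)                            ∎
    vanish : ∀ {N} {c : ℕ → ℚ} → (∀ i → N < i → c i ≡ 0ℚ) → ∀ i → N < i → c i * M i ≡ 0ℚ
    vanish {c = c} c≗0 i N<i = trans (cong (_* M i) (c≗0 i N<i)) (*-zeroˡ (M i))

  -- The empty outer sum realises the convention of the theorem for indices above 2k and gives
  -- `polynomial-product` its degree bounds.
  coefficient-vanish : ∀ k z d → 2 ℕ.* k < d → coefficient d k z ≡ 0ℚ
  coefficient-vanish k z d 2k<d = ∑-empty (λ i → stirling-weight i d * inner k z i) 2k<d

  -- These are m + π(m) = 2 ⌈m/2⌉ and m - π(m) = 2 ⌊m/2⌋, the reason why m - z = 2y holds with z =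
  -- -π(m) for white and z = π(m) for black.
  +-π≡2*extraCells : ∀ m → m ℕ.+ π m ≡ 2 ℕ.* extraCells true m × m ≡ π m ℕ.+ 2 ℕ.* extraCells false m
  +-π≡2*extraCells zero          = refl , refl
  +-π≡2*extraCells (suc zero)    = refl , refl
  +-π≡2*extraCells (suc (suc m)) with eq₁ , eq₂ ← +-π≡2*extraCells m =
    trans (cong (suc ∘ suc) eq₁) (double (extraCells true m)) ,
    trans (cong (suc ∘ suc) eq₂) (trans (sym (ℕ.+-assoc 2 (π m) _)) (trans (cong (ℕ._+ 2 ℕ.* extraCells false m) (ℕ.+-comm 2 (π m)))
      (trans (ℕ.+-assoc (π m) 2 _) (cong (π m ℕ.+_) (double (extraCells false m))))))
    where
    double : ∀ y → 2 ℕ.+ 2 ℕ.* y ≡ 2 ℕ.* suc y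
    double y = sym (ℕ.*-suc 2 y)

  R-W≡polynomial : ∀ m k → fromℕ (R-W m k) ≡ (∑ 0 (2 ℕ.* k) λ d → c-W d k (π m) * fromℕ (m ℕ.^ d))
  R-W≡polynomial m k = trans (cong ι (R-W≡F m k)) (sym (polynomial≡F m (extraCells true m) k (ℤ.- + π m) (begin
    + m ℤ.- ℤ.- + π m               ≡⟨ cong (λ t → + m ℤ.+ t) (ℤ.neg-involutive (+ π m)) ⟩
    + (m ℕ.+ π m)                   ≡⟨ cong +_ (proj₁ (+-π≡2*extraCells m)) ⟩
    + (2 ℕ.* extraCells true m)     ≡⟨ ℤ.pos-* 2 (extraCells true m) ⟩
    + 2 ℤ.* + extraCells true m     ∎)))

  R-K≡polynomial : ∀ m k → fromℕ (R-K m k) ≡ (∑ 0 (2 ℕ.* k) λ d → c-K d k (π m) * fromℕ (m ℕ.^ d))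
  R-K≡polynomial m k = trans (cong ι (R-K≡F m k)) (sym (polynomial≡F m (extraCells false m) k (+ π m) (begin
    + m ℤ.- + π m                                      ≡⟨ cong (λ t → + t ℤ.- + π m) (proj₂ (+-π≡2*extraCells m)) ⟩
    + π m ℤ.+ + (2 ℕ.* extraCells false m) ℤ.- + π m   ≡⟨ cancel (+ π m) (+ (2 ℕ.* extraCells false m)) ⟩
    + (2 ℕ.* extraCells false m)                       ≡⟨ ℤ.pos-* 2 (extraCells false m) ⟩
    + 2 ℤ.* + extraCells false m                       ∎)))
    where
    cancel : ∀ a b → a ℤ.+ b ℤ.- a ≡ b
    cancel = ℤ.solve-∀

  B-S≡polynomial : ∀ m k → fromℕ (B-S m k) ≡
    (∑ 0 (2 ℕ.* k) λ d → (∑ 0 k λ j → ∑ 0 d λ i → c-W i j (π m) * c-K (d ∸ i) (k ∸ j) (π m)) * fromℕ (m ℕ.^ d))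
  B-S≡polynomial m k = begin
    fromℕ (B-S m k)
      ≡⟨ cong ι (B-S≡⋆ m k) ⟩
    ι (((λ j → + R-W m j) ⋆ (λ j → + R-K m j)) k)
      ≡⟨ ∑-ι k (λ j → + R-W m j ℤ.* + R-K m (k ∸ j)) ⟨
    (∑ 0 k λ j → ι (+ R-W m j ℤ.* + R-K m (k ∸ j)))
      ≡⟨ ∑-cong≤ k (λ j j≤k → begin
           ι (+ R-W m j ℤ.* + R-K m (k ∸ j))
             ≡⟨ ι-* (+ R-W m j) (+ R-K m (k ∸ j)) ⟩
           fromℕ (R-W m j) * fromℕ (R-K m (k ∸ j))
             ≡⟨ cong₂ _*_ (R-W≡polynomial m j) (R-K≡polynomial m (k ∸ j)) ⟩
           (∑ 0 (2 ℕ.* j) λ d → c-W d j (π m) * M d) * (∑ 0 (2 ℕ.* (k ∸ j)) λ d → c-K d (k ∸ j) (π m) * M d)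
             ≡⟨ polynomial-product m (2 ℕ.* j) (2 ℕ.* (k ∸ j)) (λ i → c-W i j (π m)) (λ i → c-K i (k ∸ j) (π m))
                  (coefficient-vanish j (ℤ.- + π m)) (coefficient-vanish (k ∸ j) (+ π m)) ⟨
           (∑ 0 (2 ℕ.* (k ∸ j) ℕ.+ 2 ℕ.* j) λ d → c j d * M d)
             -- The degrees 2j and 2 (k - j) add up to 2k for every j, so the sums over j and d can
             -- be exchanged.
             ≡⟨ cong (λ n → ∑ 0 n λ d → c j d * M d)
                  (trans (sym (ℕ.*-distribˡ-+ 2 (k ∸ j) j)) (cong (2 ℕ.*_) (ℕ.m∸n+n≡m j≤k))) ⟩
           (∑ 0 (2 ℕ.* k) λ d → c j d * M d) ∎) ⟩
    (∑ 0 k λ j → ∑ 0 (2 ℕ.* k) λ d → c j d * M d)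
      ≡⟨ ∑-swap 0 k 0 (2 ℕ.* k) (λ j d → c j d * M d) ⟩
    (∑ 0 (2 ℕ.* k) λ d → ∑ 0 k λ j → c j d * M d)
      ≡⟨ ∑-cong 0 (2 ℕ.* k) (λ d → ∑-*ʳ 0 k (M d) (λ j → c j d)) ⟩
    (∑ 0 (2 ℕ.* k) λ d → (∑ 0 k λ j → c j d) * M d) ∎
    where
    M : ℕ → ℚ
    M d = fromℕ (m ℕ.^ d)
    c : ℕ → ℕ → ℚ
    c j d = ∑ 0 d λ i → c-W i j (π m) * c-K (d ∸ i) (k ∸ j) (π m)

open import Data.Nat.Base as ℕ using (ℕ; _∸_)
open import Data.Product.Base using (_×_; _,_)
open import Data.Rational.Base using (_*_)
open import Relation.Binary.PropositionalEquality.Core using (_≡_)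

theorem2p6 : ∀ (m k : ℕ) →
    fromℕ (R-W m k) ≡ (∑[ d from 0 to 2 ℕ.* k ] c-W d k (π m) * fromℕ (m ℕ.^ d))
    × fromℕ (R-K m k) ≡ (∑[ d from 0 to 2 ℕ.* k ] c-K d k (π m) * fromℕ (m ℕ.^ d))
    × fromℕ (B-S m k) ≡ (∑[ d from 0 to 2 ℕ.* k ] (∑[ j from 0 to k ] ∑[ i from 0 to d ] c-W i j (π m) * c-K (d ∸ i) (k ∸ j) (π m)) * fromℕ (m ℕ.^ d))
theorem2p6 m k = R-W≡polynomial m k , R-K≡polynomial m k , B-S≡polynomial m k
  where open Coefficients
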